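{- The graph classes expressible by a set $\mathcal F$ of $2$-edge-coloured graphs on three vertices with at most two edges (i.e. $\mathcal F\subseteq\{3K_1, {}^r\overline{P_3}, {}^b\overline{P_3}, {}^rP_3, {}^bP_3, {}^{rb}P_3\}$) are exactly the following classes, each being expressed by the indicated set (where one is indicated): 1. all graphs, expressed e.g. by $\{{}^r\overline{P_3}\}$; 2. complete multipartite graphs; 3. clusters, expressed by $\{{}^rP_3,{}^bP_3,{}^{rb}P_3\}$; 4. $3K_1$-free graphs, expressed by $\{3K_1\}$; 5. complete graphs minus a matching, expressed by $\{3K_1,{}^r\overline{P_3},{}^b\overline{P_3}\}$; 6. independent sets (edgeless graphs) and complete graphs, expressed by $\{{}^r\overline{P_3},{}^b\overline{P_3},{}^rP_3,{}^bP_3,{}^{rb}P_3\}$; 7. disjoint unions of at most two cliques, expressed by $\{3K_1,{}^rP_3,{}^bP_3,{}^{rb}P_3\}$; 8. complete graphs and $2K_1$, expressed by $\{3K_1,{}^r\overline{P_3},{}^b\overline{P_3},{}^rP_3,{}^bP_3,{}^{rb}P_3\}$; 9. independent sets and complete graphs minus a matching, expressed by $\{{}^r\overline{P_3},{}^b\overline{P_3},{}^rP_3,{}^bP_3\}$; 10. $\{K_1+P_3, C_5\}$-free graphs, expressed by $\{{}^b\overline{P_3},{}^rP_3\}$; 11. $\{3K_1,C_5\}$-free graphs, expressed by $\{3K_1,{}^b\overline{P_3},{}^rP_3\}$; 12. joins of clusters, expressed by $\{{}^b\overline{P_3},{}^rP_3,{}^{rb}P_3\}$; 13. joins of clusters where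 each cluster contains at most two cliques, expressed by $\{3K_1,{}^b\overline{P_3},{}^rP_3,{}^{rb}P_3\}$; 14. co-bipartite graphs and clusters, expressed by $\{{}^b\overline{P_3},{}^rP_3,{}^bP_3\}$; 15. co-bipartite graphs, expressed by $\{3K_1,{}^rP_3,{}^bP_3\}$; 16. elementary graphs, expressed by $\{{}^rP_3,{}^bP_3\}$.
   Context: Graphs are finite and simple. A $2$-edge-colouring of $G$ assigns to every edge the colour red or blue (not necessarily properly). For a set $\mathcal F$ of $2$-edge-coloured graphs, a $2$-edge-colouring of $G$ is $\mathcal F$-free if no induced $2$-edge-coloured subgraph is isomorphic (preserving colours) to a member of $\mathcal F$. The set $\mathcal F$ expresses the class of all graphs that admit an $\mathcal F$-free $2$-edge-colouring. Patterns on three vertices: $3K_1$ is the edgeless graph; ${}^r\overline{P_3}$ (resp. ${}^b\overline{P_3}$) has exactly one edge, coloured red (resp. blue); ${}^rP_3$ (resp. ${}^bP_3$) is the path on three vertices with both edges red (resp. blue); ${}^{rb}P_3$ is the path on three vertices with one red and one blue edge. A cluster is a disjoint union of complete graphs. A graph is co-bipartite if it is the complement of a bipartite graph (its vertex set can be covered by at most two cliques). A complete graph minus a matching is a graph obtained from a complete graph by deleting a (possibly empty) matching. $+$ denotes disjoint union; the join of graphs is obtained from their disjoint union by adding all edges between different graphs; "join of clusters" means the join of one or more clusters. An elementary graph is, by definition, a graph admitting a $2$-edge-colouring with no monochromatic induced path on three vertices. For uncoloured graphs, being free of a set of graphs means containing no induced subgraph isomorphic to a member. -}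

module Defs where

open import Data.Bool.Base using (Bool; true; false; not; _∧_; _∨_; T)
open import Data.Bool.ListAction using (any)
open import Data.Bool.Properties using (∨-comm)
open import Data.Fin.Base using (Fin; zero; suc; splitAt)
open import Data.Fin.Patterns using (0F; 1F; 2F; 3F; 4F)
open import Data.Fin.Properties using (_≟_)
open import Data.List.Base using (List; []; _∷_; [_])
open import Data.List.Relation.Unary.All using (All)
open import Data.Maybe.Base using (Maybe; just; nothing)
open import Data.Nat.Base using (ℕ; suc; _+_; _≤_)
open import Data.Product.Base using (Σ; ∃; ∃-syntax; _×_; _,_; proj₁)
open import Data.Sum.Base using (_⊎_; inj₁; inj₂)
open import Data.Unit.Base using (⊤)
open import Function.Base using (_∘_)
open import Function.Bundles using (_⇔_; _↣_; _↔_; Injection; Inverse)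
open import Level using (0ℓ)
open import Relation.Binary.PropositionalEquality
  using (_≡_; _≢_; refl; sym; cong; cong₂)
open import Relation.Nullary using (¬_; yes; no; contradiction)
open import Relation.Nullary.Decidable using (⌊_⌋)
open import Relation.Unary using (Pred)

private
  variable
    V W : Set
    m n : ℕ

record Graph (V : Set) : Set where
  field
    adj        : V → V → Bool
    adj-sym    : ∀ u v → adj u v ≡ adj v u
    adj-irrefl : ∀ v → adj v v ≡ false

  infix 4 _~_
  _~_ : V → V → Set
  u ~ v = T (adj u v)

open Graph using (adj; adj-sym; adj-irrefl)

FiniteGraph : Set
FiniteGraph = ∃[ n ] Graph (Fin n)

GraphClass : Set₁
GraphClass = Pred FiniteGraph 0ℓ

-- For injective f this is, up to isomorphism, the subgraph of G induced
-- on the image of f.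
induce : Graph V → (W → V) → Graph W
induce G f = record
  { adj        = λ u v → adj G (f u) (f v)
  ; adj-sym    = λ u v → adj-sym G (f u) (f v)
  ; adj-irrefl = λ v → adj-irrefl G (f v)
  }

infix 4 _≅_ _⊑_

_≅_ : Graph V → Graph W → Set
_≅_ {V} {W} G H =
  Σ (V ↔ W) λ φ → let open Inverse φ in
    ∀ u v → adj G u v ≡ adj H (to u) (to v)

-- An injection preserving and reflecting adjacency is an isomorphism onto
-- the subgraph induced on its image, so H ⊑ G says that some induced
-- subgraph of G is isomorphic to H.
_⊑_ : Graph W → Graph V → Set
_⊑_ {W} {V} H G =
  Σ (W ↣ V) λ φ → let open Injection φ in
    ∀ u v → adj H u v ≡ adj G (to u) (to v)

Free : List FiniteGraph → Graph V → Set
Free 𝓗 G = All (λ (_ , H) → ¬ (H ⊑ G)) 𝓗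

distinct : Fin n → Fin n → Bool
distinct u v = not ⌊ u ≟ v ⌋

distinct-sym : (u v : Fin n) → distinct u v ≡ distinct v u
distinct-sym u v with u ≟ v | v ≟ u
... | yes _   | yes _   = refl
... | no _    | no _    = refl
... | yes u≡v | no v≢u  = contradiction (sym u≡v) v≢u
... | no u≢v  | yes v≡u = contradiction (sym v≡u) u≢v

distinct-irrefl : (v : Fin n) (b : Bool) → distinct v v ∧ b ≡ false
distinct-irrefl v b with v ≟ v
... | yes _  = refl
... | no v≢v = contradiction refl v≢v

fromEdges : ∀ n → List (Fin n × Fin n) → Graph (Fin n)
fromEdges n es = record
  { adj        = λ u v → distinct u v ∧ (listed u v ∨ listed v u)
  ; adj-sym    = λ u v → cong₂ _∧_ (distinct-sym u v) (∨-comm (listed u v) (listed v u))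
  ; adj-irrefl = λ v → distinct-irrefl v _
  }
  where
  listed : Fin n → Fin n → Bool
  listed u v = any (λ (x , y) → ⌊ u ≟ x ⌋ ∧ ⌊ v ≟ y ⌋) es

complement : Graph (Fin n) → Graph (Fin n)
complement G = record
  { adj        = λ u v → distinct u v ∧ not (adj G u v)
  ; adj-sym    = λ u v → cong₂ _∧_ (distinct-sym u v) (cong not (adj-sym G u v))
  ; adj-irrefl = λ v → distinct-irrefl v _
  }

_⊎ᴳ_ : Graph V → Graph W → Graph (V ⊎ W)
G ⊎ᴳ H = record
  { adj        = a
  ; adj-sym    = λ { (inj₁ u) (inj₁ v) → adj-sym G u v
                   ; (inj₁ _) (inj₂ _) → refl
                   ; (inj₂ _) (inj₁ _) → refl
                   ; (inj₂ u) (inj₂ v) → adj-sym H u v }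
  ; adj-irrefl = λ { (inj₁ v) → adj-irrefl G v
                   ; (inj₂ v) → adj-irrefl H v }
  }
  where
  a : _ ⊎ _ → _ ⊎ _ → Bool
  a (inj₁ u) (inj₁ v) = adj G u v
  a (inj₂ u) (inj₂ v) = adj H u v
  a _        _        = false

infixl 6 _+ᴳ_
_+ᴳ_ : Graph (Fin m) → Graph (Fin n) → Graph (Fin (m + n))
_+ᴳ_ {m} G H = induce (G ⊎ᴳ H) (splitAt m)

K₁ : Graph (Fin 1)
K₁ = fromEdges 1 []

2K₁ : Graph (Fin 2)
2K₁ = fromEdges 2 []

3K₁ : Graph (Fin 3)
3K₁ = fromEdges 3 []

coP₃ : Graph (Fin 3)
coP₃ = fromEdges 3 [ (0F , 1F) ]

P₃ : Graph (Fin 3)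
P₃ = fromEdges 3 ((0F , 1F) ∷ (1F , 2F) ∷ [])

C₅ : Graph (Fin 5)
C₅ = fromEdges 5
  ((0F , 1F) ∷ (1F , 2F) ∷ (2F , 3F) ∷ (3F , 4F) ∷ (4F , 0F) ∷ [])

data Colour : Set where
  red blue : Colour

record Colouring (G : Graph V) : Set where
  open Graph G using (_~_)
  field
    colour     : ∀ u v → u ~ v → Colour
    colour-sym : ∀ u v (e : u ~ v) (e′ : v ~ u) → colour u v e ≡ colour v u e′

open Colouring using (colour)

record ColouredGraph : Set where
  constructor coloured
  field
    {order}   : ℕ
    graph     : Graph (Fin order)
    colouring : Colouring graph

-- The colour-preserving counterpart of _⊑_.
OccursIn : ColouredGraph → (G : Graph V) → Colouring G → Set
OccursIn {V} (coloured {k} H d) G c =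
  Σ (Fin k ↣ V) λ φ → let open Injection φ in
    (∀ u v → adj H u v ≡ adj G (to u) (to v)) ×
    (∀ u v e e′ → colour d u v e ≡ colour c (to u) (to v) e′)

ColourFree : List ColouredGraph → (G : Graph V) → Colouring G → Set
ColourFree 𝓕 G c = All (λ P → ¬ OccursIn P G c) 𝓕

Expresses : List ColouredGraph → GraphClass → Set
Expresses 𝓕 𝓒 = ∀ n (G : Graph (Fin n)) →
  𝓒 (n , G) ⇔ (Σ (Colouring G) λ c → ColourFree 𝓕 G c)

monochromatic : (G : Graph V) → Colour → Colouring G
monochromatic G x = record
  { colour     = λ _ _ _ → x
  ; colour-sym = λ _ _ _ _ → refl
  }

bicoloured : Colouring P₃
bicoloured = record
  { colour     = λ { 0F 1F _ → red
                   ; 1F 0F _ → red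
                   ; _  _  _ → blue }
  ; colour-sym = λ { 0F 1F _ _ → refl
                   ; 1F 0F _ _ → refl
                   ; 1F 2F _ _ → refl
                   ; 2F 1F _ _ → refl
                   ; 2F 2F () _ }
  }

-- The choice of red is vacuous, as 3K₁ has no edges.
∅3K₁ : ColouredGraph
∅3K₁ = coloured 3K₁ (monochromatic 3K₁ red)

rcoP₃ bcoP₃ rP₃ bP₃ rbP₃ : ColouredGraph
rcoP₃ = coloured coP₃ (monochromatic coP₃ red)
bcoP₃ = coloured coP₃ (monochromatic coP₃ blue)
rP₃   = coloured P₃ (monochromatic P₃ red)
bP₃   = coloured P₃ (monochromatic P₃ blue)
rbP₃  = coloured P₃ bicoloured

patterns : List ColouredGraph
patterns = ∅3K₁ ∷ rcoP₃ ∷ bcoP₃ ∷ rP₃ ∷ bP₃ ∷ rbP₃ ∷ []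

Edgeless : Graph V → Set
Edgeless G = ∀ u v → ¬ u ~ v
  where open Graph G

Complete : Graph V → Set
Complete G = ∀ u v → u ≢ v → u ~ v
  where open Graph G

-- G is the disjoint union, respectively the join, of the k subgraphs
-- induced on the fibres of part, and each of these has property 𝓟.
-- Fibres may be empty; the empty graph is complete and a cluster.
DisjointUnionOf : ℕ → (∀ {W} → Graph W → Set) → Graph V → Set
DisjointUnionOf {V} k 𝓟 G = Σ (V → Fin k) λ part →
  (∀ u v → part u ≢ part v → ¬ u ~ v) ×
  (∀ i → 𝓟 (induce G (proj₁ {A = V} {B = λ v → part v ≡ i})))
  where open Graph G

JoinOf : ℕ → (∀ {W} → Graph W → Set) → Graph V → Set
JoinOf {V} k 𝓟 G = Σ (V → Fin k) λ part →
  (∀ u v → part u ≢ part v → u ~ v) ×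
  (∀ i → 𝓟 (induce G (proj₁ {A = V} {B = λ v → part v ≡ i})))
  where open Graph G

CompleteMultipartite : Graph V → Set
CompleteMultipartite G = ∃[ k ] JoinOf k Edgeless G

Cluster : Graph V → Set
Cluster G = ∃[ k ] DisjointUnionOf k Complete G

AtMostTwoCliques : Graph V → Set
AtMostTwoCliques G = ∃[ k ] k ≤ 2 × DisjointUnionOf k Complete G

Matching : Graph V → Set
Matching M = ∀ u v w → u ~ v → u ~ w → v ≡ w
  where open Graph M

CompleteMinusMatching : Graph V → Set
CompleteMinusMatching {V} G = Σ (Graph V) λ M →
  Matching M × (∀ u v → Graph._~_ G u v ⇔ (u ≢ v × ¬ Graph._~_ M u v))

Bipartite : Graph V → Set
Bipartite {V} G = Σ (V → Fin 2) λ side → ∀ u v → u ~ v → side u ≢ side v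
  where open Graph G

CoBipartite : Graph (Fin n) → Set
CoBipartite G = Bipartite (complement G)

Elementary : Graph V → Set
Elementary {V} G = Σ (Colouring G) λ c →
  ∀ u v w (e : u ~ v) (f : v ~ w) → u ≢ w → ¬ u ~ w →
    colour c u v e ≢ colour c v w f
  where open Graph G

data ClassName : Set where
  all-graphs complete-multipartite clusters 3K₁-free
    complete-minus-matching edgeless-or-complete at-most-two-cliques
    complete-or-2K₁ edgeless-or-complete-minus-matching
    K₁+P₃,C₅-free 3K₁,C₅-free joins-of-clusters
    joins-of-clusters-with-at-most-two-cliques
    co-bipartite-or-cluster co-bipartite elementary : ClassName

-- The index suc k in the joins rules out a join of no graphs.
⟦_⟧ : ClassName → GraphClass
⟦ all-graphs ⟧                          (_ , G) = ⊤
⟦ complete-multipartite ⟧               (_ , G) = CompleteMultipartite G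
⟦ clusters ⟧                            (_ , G) = Cluster G
⟦ 3K₁-free ⟧                            (_ , G) = Free [ (_ , 3K₁) ] G
⟦ complete-minus-matching ⟧             (_ , G) = CompleteMinusMatching G
⟦ edgeless-or-complete ⟧                (_ , G) = Edgeless G ⊎ Complete G
⟦ at-most-two-cliques ⟧                 (_ , G) = AtMostTwoCliques G
⟦ complete-or-2K₁ ⟧                     (_ , G) = Complete G ⊎ G ≅ 2K₁
⟦ edgeless-or-complete-minus-matching ⟧ (_ , G) = Edgeless G ⊎ CompleteMinusMatching G
⟦ K₁+P₃,C₅-free ⟧                       (_ , G) = Free ((_ , K₁ +ᴳ P₃) ∷ (_ , C₅) ∷ []) G
⟦ 3K₁,C₅-free ⟧                         (_ , G) = Free ((_ , 3K₁) ∷ (_ , C₅) ∷ []) G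
⟦ joins-of-clusters ⟧                   (_ , G) = ∃[ k ] JoinOf (suc k) Cluster G
⟦ joins-of-clusters-with-at-most-two-cliques ⟧
                                        (_ , G) = ∃[ k ] JoinOf (suc k) AtMostTwoCliques G
⟦ co-bipartite-or-cluster ⟧             (_ , G) = CoBipartite G ⊎ Cluster G
⟦ co-bipartite ⟧                        (_ , G) = CoBipartite G
⟦ elementary ⟧                          (_ , G) = Elementary G

indicated : ClassName → Maybe (List ColouredGraph)
indicated all-graphs                          = just [ rcoP₃ ]
indicated complete-multipartite               = nothing
indicated clusters                            = just (rP₃ ∷ bP₃ ∷ rbP₃ ∷ [])
indicated 3K₁-free                            = just [ ∅3K₁ ]
indicated complete-minus-matching             = just (∅3K₁ ∷ rcoP₃ ∷ bcoP₃ ∷ [])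
indicated edgeless-or-complete                = just (rcoP₃ ∷ bcoP₃ ∷ rP₃ ∷ bP₃ ∷ rbP₃ ∷ [])
indicated at-most-two-cliques                 = just (∅3K₁ ∷ rP₃ ∷ bP₃ ∷ rbP₃ ∷ [])
indicated complete-or-2K₁                     = just (∅3K₁ ∷ rcoP₃ ∷ bcoP₃ ∷ rP₃ ∷ bP₃ ∷ rbP₃ ∷ [])
indicated edgeless-or-complete-minus-matching = just (rcoP₃ ∷ bcoP₃ ∷ rP₃ ∷ bP₃ ∷ [])
indicated K₁+P₃,C₅-free                       = just (bcoP₃ ∷ rP₃ ∷ [])
indicated 3K₁,C₅-free                         = just (∅3K₁ ∷ bcoP₃ ∷ rP₃ ∷ [])
indicated joins-of-clusters                   = just (bcoP₃ ∷ rP₃ ∷ rbP₃ ∷ [])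
indicated joins-of-clusters-with-at-most-two-cliques
                                              = just (∅3K₁ ∷ bcoP₃ ∷ rP₃ ∷ rbP₃ ∷ [])
indicated co-bipartite-or-cluster             = just (bcoP₃ ∷ rP₃ ∷ bP₃ ∷ [])
indicated co-bipartite                        = just (∅3K₁ ∷ rP₃ ∷ bP₃ ∷ [])
indicated elementary                          = just (rP₃ ∷ bP₃ ∷ [])

{-# OPTIONS --safe #-}

-- For each class there are sets L ⊆ U of patterns such that a graph with an
-- L-free colouring lies in the class and every graph in the class has a U-free
-- colouring; then each set between L and U expresses the class.  Up to swapping
-- the colours, the 64 sets of patterns are covered by 17 such intervals.
--
-- Most steps are local.  Avoiding co x says that every edge with a common
-- non-neighbour has colour other x.  The exception is that a 3K₁-free graph
-- without monochromatic induced P₃ is co-bipartite: along a shortest odd cycle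
-- of the complement, the colours of the chords alternate inconsistently.

module Submission where

open import Data.Bool.Base using (Bool; true; false; not; _xor_; if_then_else_; T)
open import Data.Bool.Properties
  using (T-≡; T-irrelevant; T?; xor-same; ¬-not; not-distribˡ-xor; not-involutive)
  renaming (_≟_ to _≟ᵇ_)
open import Data.Empty using (⊥; ⊥-elim)
open import Data.Fin.Base as Fin using (Fin; zero; suc; inject₁; inject≤)
open import Data.Fin.Patterns using (0F; 1F; 2F; 3F; 4F)
open import Data.Fin.Properties
  using (_≟_; any?; inject₁-injective; inject≤-injective; <-cmp; <-asym; _<?_)
open import Data.List.Base
  using (List; []; _∷_; [_]; _++_; map; filter; lookup; allFin; cartesianProduct; cartesianProductWith; tabulate)
open import Data.List.Membership.Propositional using (_∈_)
open import Data.List.Membership.Propositional.Properties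
  using (∈-allFin; ∈-cartesianProduct⁺; ∈-++⁺ˡ; ∈-++⁺ʳ; ∈-map⁺; ∈-map⁻; ∈-lookup;
         ∈-filter⁺; ∈-filter⁻)
open import Data.List.Relation.Binary.Subset.Propositional using (_⊆_)
import Data.List.Relation.Binary.Subset.DecPropositional as DecSubset
import Data.List.Membership.DecPropositional as DecMembership
import Data.List.Relation.Binary.Subset.Propositional.Properties as Subset
open import Data.List.Relation.Unary.All as List using ([]; _∷_)
import Data.List.Relation.Unary.All.Properties as Listₚ
open import Data.List.Relation.Unary.AllPairs using (AllPairs; []; _∷_)
open import Data.List.Relation.Unary.Any as Any using (here; there)
open import Data.Maybe.Relation.Unary.All using (All; just; nothing)
open import Data.Nat.Base using (ℕ; zero; suc; _+_; _≤_; _<_; z≤n; s≤s; _%_; _/_)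
open import Data.Nat.DivMod using (m%n<n; m≡m%n+[m/n]*n; [m+kn]%n≡m%n; [m+n]%n≡m%n; m<n⇒m%n≡m; n%n≡0)
open import Data.Nat.Induction using (<-rec)
open import Data.Nat.Properties
  using (+-suc; +-comm; +-assoc; +-identityʳ; m≤m+n; m≤n+m; m≤n⇒m<n∨m≡n; ≤-refl; m≤n⇒m≤1+n)
open import Data.Product.Base using (Σ; Σ-syntax; ∃; ∃-syntax; _×_; _,_; proj₁; proj₂; map₂)
open import Data.Sum.Base using (_⊎_; inj₁; inj₂; [_,_]′)
open import Data.Unit.Base using (tt)
open import Data.Vec.Base as Vec using ([]; _∷_)
open import Function.Base using (_∘_; id; const)
open import Function.Bundles using (_⇔_; mk⇔; mk↣; mk↔ₛ′; Equivalence; Injection; Inverse)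
open import Function.Properties.Inverse using (↔⇒↣)
open import Relation.Binary.Definitions
  using (Decidable; DecidableEquality; Symmetric; tri<; tri≈; tri>)
open import Relation.Binary.PropositionalEquality
  using (_≡_; _≢_; refl; sym; trans; cong; subst; subst₂; ≢-sym; module ≡-Reasoning)
open import Relation.Binary.Structures using (IsEquivalence)
open import Relation.Nullary using (¬_; Dec; yes; no; does; contradiction)
open import Relation.Nullary.Decidable
  using (_×-dec_; _→-dec_; _⊎-dec_; ¬?; map′; does-⇔; dec-true; dec-false; True; toWitness; decidable-stable)
open import Relation.Unary using (_≐_)
import Relation.Unary as Unary
open import Axiom.UniquenessOfIdentityProofs using (module Decidable⇒UIP)
open import Defs

open Graph using (adj; adj-sym; adj-irrefl)
open Colouring using (colour; colour-sym)

-- Sixteen classes need seventeen intervals because of the complete graphs minus a matching. Once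
-- `3K₁` and both one-edge patterns are excluded, any two of the three coloured paths can be
-- excluded at no cost, by a constant colouring or by one that makes every induced `P₃` bicoloured.
-- Excluding all three excludes `P₃` itself, so no single upper set suffices.
--
-- The non-constant colourings share one principle: colour an edge by whether a label agrees at its
-- two ends. If non-adjacent vertices always have different labels (sides of a bipartition, ends of
-- a matching edge), every induced `P₃` is bicoloured; if they always have equal labels (parts of a
-- join), every induced `P₃` is monochromatic. The colouring forced by common non-neighbours is the
-- exception.
--
-- Partitions must be given as functions into a finite set. They are read off from decidable
-- relations that the excluded patterns already make transitive: non-adjacency, being equal or
-- adjacent, and being at distance at most 2 in the complement. No transitive closure is ever
-- formed.

private
  variable
    V W : Set
    k m n : ℕ
    u v w : V
    x y : Colour
    b b′ : Bool

-- Adjacency and forbidden uncoloured configurations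

module Adjacency (G : Graph V) where
  open Graph G using (_~_) public

  infix 4 _≁_
  -- Adjacency in the complement. Distinctness is built in, so a configuration that lists `_~_` or
  -- `_≁_` for every pair has distinct vertices automatically.
  _≁_ : V → V → Set
  u ≁ v = u ≢ v × ¬ u ~ v

  ~-sym : u ~ v → v ~ u
  ~-sym {u} {v} = subst T (adj-sym G u v)

  ~-irrefl : ¬ v ~ v
  ~-irrefl {v} = subst T (adj-irrefl G v)

  ~⇒≢ : u ~ v → u ≢ v
  ~⇒≢ u~v refl = ~-irrefl u~v

  ≁-sym : u ≁ v → v ≁ u
  ≁-sym (u≢v , ¬u~v) = ≢-sym u≢v , ¬u~v ∘ ~-sym

  ~⇒¬≁ : u ~ v → ¬ u ≁ v
  ~⇒¬≁ u~v (_ , ¬u~v) = ¬u~v u~v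

  ~-≁⇒≢ : u ~ v → v ≁ w → u ≢ w
  ~-≁⇒≢ u~v v≁w refl = ~⇒¬≁ (~-sym u~v) v≁w

  No3K₁ NoCoP₃ NoP₃ NoK₁+P₃ NoC₅ : Set
  No3K₁   = ∀ {u v w} → u ≁ v → v ≁ w → u ≁ w → ⊥
  NoCoP₃  = ∀ {u v w} → u ~ v → u ≁ w → v ≁ w → ⊥
  NoP₃    = ∀ {u v w} → u ~ v → v ~ w → u ≁ w → ⊥
  NoK₁+P₃ = ∀ {t u v w} → t ≁ u → t ≁ v → t ≁ w → u ~ v → v ~ w → u ≁ w → ⊥
  NoC₅    = ∀ {p q r s t} → p ~ q → q ~ r → r ~ s → s ~ t → t ~ p →
            p ≁ r → p ≁ s → q ≁ s → q ≁ t → r ≁ t → ⊥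

  -- A property of its own, since it is also required of fibres, whose vertices do not form a `Fin`.
  Trichotomous : Set
  Trichotomous = ∀ u v → u ≡ v ⊎ u ~ v ⊎ u ≁ v

module FiniteAdjacency (G : Graph (Fin n)) where
  open Adjacency G public

  infix 4 _~?_ _≁?_
  _~?_ : Decidable _~_
  u ~? v = T? (adj G u v)

  _≁?_ : Decidable _≁_
  u ≁? v = ¬? (u ≟ v) ×-dec ¬? (u ~? v)

  trichotomous : Trichotomous
  trichotomous u v with u ≟ v | u ~? v
  ... | yes u≡v | _       = inj₁ u≡v
  ... | no _    | yes u~v = inj₂ (inj₁ u~v)
  ... | no u≢v  | no ¬u~v = inj₂ (inj₂ (u≢v , ¬u~v))

  ≢-¬≁⇒~ : u ≢ v → ¬ u ≁ v → u ~ v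
  ≢-¬≁⇒~ {u} {v} u≢v ¬u≁v = decidable-stable (u ~? v) λ ¬u~v → ¬u≁v (u≢v , ¬u~v)

-- Colours and coloured patterns

other : Colour → Colour
other red  = blue
other blue = red

other-involutive : ∀ x → other (other x) ≡ x
other-involutive red  = refl
other-involutive blue = refl

≢-other : ∀ x → x ≢ other x
≢-other red  ()
≢-other blue ()

≡⊎≡other : ∀ x y → y ≡ x ⊎ y ≡ other x
≡⊎≡other red  red  = inj₁ refl
≡⊎≡other red  blue = inj₂ refl
≡⊎≡other blue red  = inj₂ refl
≡⊎≡other blue blue = inj₁ refl

both-colours : {P : Colour → Set} → P red → P blue → ∀ x → P x
both-colours r b red  = r
both-colours r b blue = b

-- Codes for the six patterns. Unlike for coloured graphs, membership and inclusion are decidable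
-- for them, and a colour can be a variable.
data Pattern : Set where
  independent : Pattern
  co path     : Colour → Pattern
  mixed       : Pattern

pattern-graph : Pattern → ColouredGraph
pattern-graph independent = ∅3K₁
pattern-graph (co x)      = coloured coP₃ (monochromatic coP₃ x)
pattern-graph (path x)    = coloured P₃ (monochromatic P₃ x)
pattern-graph mixed       = rbP₃

module ColouredEdges {G : Graph V} (c : Colouring G) where
  open Adjacency G

  Edge : Colour → V → V → Set
  Edge x u v = Σ[ e ∈ u ~ v ] colour c u v e ≡ x

  edge-sym : Edge x u v → Edge x v u
  edge-sym (e , c≡x) = ~-sym e , trans (sym (colour-sym c _ _ e (~-sym e))) c≡x

  edge : u ~ v → ∃[ x ] Edge x u v
  edge e = _ , e , refl

  edge-cases : ∀ x → u ~ v → Edge x u v ⊎ Edge (other x) u v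
  edge-cases x e with ≡⊎≡other x (colour c _ _ e)
  ... | inj₁ c≡x = inj₁ (e , c≡x)
  ... | inj₂ c≡y = inj₂ (e , c≡y)

  edge-unique : Edge x u v → Edge y u v → x ≡ y
  edge-unique (e , refl) (e′ , refl) = cong (colour c _ _) (T-irrelevant e e′)

  NoMonochromaticP₃ : Set
  NoMonochromaticP₃ = ∀ x {u v w} → Edge x u v → Edge x v w → ¬ u ≁ w

Absent : Pattern → {G : Graph V} → Colouring G → Set
Absent independent {G} c = Adjacency.No3K₁ G
Absent (co x) {G} c = ∀ {u v w} → Edge x u v → u ≁ w → ¬ v ≁ w
  where
  open Adjacency G
  open ColouredEdges c
Absent (path x) {G} c = ∀ {u v w} → Edge x u v → Edge x v w → ¬ u ≁ w
  where
  open Adjacency G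
  open ColouredEdges c
Absent mixed {G} c = ∀ {u v w} → Edge red u v → Edge blue v w → ¬ u ≁ w
  where
  open Adjacency G
  open ColouredEdges c

Avoids : List Pattern → {G : Graph V} → Colouring G → Set
Avoids ps c = List.All (λ p → Absent p c) ps

-- Embeddings

lookup-pair : {f : Fin k → V} {R : V → V → Set} → AllPairs R (tabulate f) →
              ∀ {i j} → i Fin.< j → R (f i) (f j)
lookup-pair (rs ∷ _)  {zero}  {suc j} _         = Listₚ.tabulate⁻ rs j
lookup-pair (_  ∷ ps) {suc i} {suc j} (s≤s i<j) = lookup-pair ps i<j
lookup-pair (_  ∷ _)  {_}     {zero}  ()

module Embedding (H : Graph (Fin k)) (G : Graph V) (f : Fin k → V) where

  Match : Fin k → Fin k → Set
  Match i j = f i ≢ f j × adj H i j ≡ adj G (f i) (f j)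

  -- Symmetry and irreflexivity leave only the pairs `i < j` to check. For a concrete `k` these
  -- unfold to a triangular list with one entry per pair.
  embed : AllPairs Match (allFin k) → H ⊑ G
  embed ps = mk↣ injective , adj-≡
    where
    injective : ∀ {i j} → f i ≡ f j → i ≡ j
    injective {i} {j} fi≡fj with <-cmp i j
    ... | tri< i<j _ _ = contradiction fi≡fj (proj₁ (lookup-pair ps i<j))
    ... | tri≈ _ i≡j _ = i≡j
    ... | tri> _ _ j<i = contradiction (sym fi≡fj) (proj₁ (lookup-pair ps j<i))

    adj-≡ : ∀ i j → adj H i j ≡ adj G (f i) (f j)
    adj-≡ i j with <-cmp i j
    ... | tri< i<j _ _  = proj₂ (lookup-pair ps i<j)
    ... | tri≈ _ refl _ = trans (adj-irrefl H i) (sym (adj-irrefl G (f i)))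
    ... | tri> _ _ j<i  =
      trans (adj-sym H i j) (trans (proj₂ (lookup-pair ps j<i)) (adj-sym G (f j) (f i)))

  module _ (d : Colouring H) (c : Colouring G) where

    ColourMatch : Fin k → Fin k → Set
    ColourMatch i j = ∀ e e′ → colour d i j e ≡ colour c (f i) (f j) e′

    embed-coloured : AllPairs Match (allFin k) → AllPairs ColourMatch (allFin k) →
                     OccursIn (coloured H d) G c
    embed-coloured ps qs = proj₁ (embed ps) , proj₂ (embed ps) , colour-≡
      where
      colour-≡ : ∀ i j → ColourMatch i j
      colour-≡ i j e e′ with <-cmp i j
      ... | tri< i<j _ _  = lookup-pair qs i<j e e′
      ... | tri≈ _ refl _ = ⊥-elim (Adjacency.~-irrefl H e)
      ... | tri> _ _ j<i  =
        trans (colour-sym d i j e (Adjacency.~-sym H e))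
          (trans (lookup-pair qs j<i _ (Adjacency.~-sym G e′)) (sym (colour-sym c _ _ _ _)))

module _ (G : Graph V) where
  open Adjacency G

  -- The literal stands on the left because `adj H i j` computes to it for a concrete `H`; the
  -- result is then directly an entry for `embed`.
  adjacent : u ~ v → u ≢ v × true ≡ adj G u v
  adjacent u~v = ~⇒≢ u~v , sym (Equivalence.to T-≡ u~v)

  nonadjacent : u ≁ v → u ≢ v × false ≡ adj G u v
  nonadjacent {u} {v} (u≢v , ¬u~v) with adj G u v
  ... | true  = ⊥-elim (¬u~v _)
  ... | false = u≢v , refl

  adjacent⁻ : true ≡ adj G u v → u ~ v
  adjacent⁻ = Equivalence.from T-≡ ∘ sym

  nonadjacent⁻ : u ≢ v → false ≡ adj G u v → u ≁ v
  nonadjacent⁻ u≢v ≡false = u≢v , subst T (sym ≡false)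

module Image (H : Graph W) (G : Graph V) (φ : H ⊑ G) where
  open Adjacency G
  open Injection (proj₁ φ) using (to; injective)

  image-~ : ∀ i j → true ≡ adj H i j → to i ~ to j
  image-~ i j eq = adjacent⁻ G (trans eq (proj₂ φ i j))

  image-≁ : ∀ i j → i ≢ j → false ≡ adj H i j → to i ≁ to j
  image-≁ i j i≢j eq = nonadjacent⁻ G (i≢j ∘ injective) (trans eq (proj₂ φ i j))

module _ (G : Graph V) where
  open Adjacency G

  free-3K₁⇔ : Free [ (_ , 3K₁) ] G ⇔ No3K₁
  free-3K₁⇔ = mk⇔
    (λ { (¬φ ∷ []) {u} {v} {w} u≁v v≁w u≁w →
      ¬φ (Embedding.embed 3K₁ G (Vec.lookup (u ∷ v ∷ w ∷ []))
        ( (nonadjacent G u≁v ∷ nonadjacent G u≁w ∷ [])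
        ∷ (nonadjacent G v≁w ∷ [])
        ∷ [] ∷ [])) })
    (λ no3K₁ → (λ φ → let open Image 3K₁ G φ in
      no3K₁ (image-≁ 0F 1F (λ ()) refl) (image-≁ 1F 2F (λ ()) refl) (image-≁ 0F 2F (λ ()) refl))
      ∷ [])

  no-K₁+P₃⇔ : (¬ (K₁ +ᴳ P₃) ⊑ G) ⇔ NoK₁+P₃
  no-K₁+P₃⇔ = mk⇔
    (λ { ¬φ {t} {u} {v} {w} t≁u t≁v t≁w u~v v~w u≁w →
      ¬φ (Embedding.embed (K₁ +ᴳ P₃) G (Vec.lookup (t ∷ u ∷ v ∷ w ∷ []))
        ( (nonadjacent G t≁u ∷ nonadjacent G t≁v ∷ nonadjacent G t≁w ∷ [])
        ∷ (adjacent G u~v ∷ nonadjacent G u≁w ∷ [])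
        ∷ (adjacent G v~w ∷ [])
        ∷ [] ∷ [])) })
    (λ no φ → let open Image (K₁ +ᴳ P₃) G φ in
      no (image-≁ 0F 1F (λ ()) refl) (image-≁ 0F 2F (λ ()) refl) (image-≁ 0F 3F (λ ()) refl)
         (image-~ 1F 2F refl) (image-~ 2F 3F refl) (image-≁ 1F 3F (λ ()) refl))

  no-C₅⇔ : (¬ C₅ ⊑ G) ⇔ NoC₅
  no-C₅⇔ = mk⇔
    (λ { ¬φ {p} {q} {r} {s} {t} p~q q~r r~s s~t t~p p≁r p≁s q≁s q≁t r≁t →
      ¬φ (Embedding.embed C₅ G (Vec.lookup (p ∷ q ∷ r ∷ s ∷ t ∷ []))
        ( (adjacent G p~q ∷ nonadjacent G p≁r ∷ nonadjacent G p≁s ∷ adjacent G (~-sym t~p) ∷ [])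
        ∷ (adjacent G q~r ∷ nonadjacent G q≁s ∷ nonadjacent G q≁t ∷ [])
        ∷ (adjacent G r~s ∷ nonadjacent G r≁t ∷ [])
        ∷ (adjacent G s~t ∷ [])
        ∷ [] ∷ [])) })
    (λ noC₅ φ → let open Image C₅ G φ in
      noC₅ (image-~ 0F 1F refl) (image-~ 1F 2F refl) (image-~ 2F 3F refl)
           (image-~ 3F 4F refl) (image-~ 4F 0F refl)
           (image-≁ 0F 2F (λ ()) refl) (image-≁ 0F 3F (λ ()) refl) (image-≁ 1F 3F (λ ()) refl)
           (image-≁ 1F 4F (λ ()) refl) (image-≁ 2F 4F (λ ()) refl))

module _ {G : Graph V} (c : Colouring G) where
  open Adjacency G
  open ColouredEdges c

  private
    triple : V → V → V → Fin 3 → V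
    triple u v w = Vec.lookup (u ∷ v ∷ w ∷ [])

    uncoloured : ∀ P → OccursIn P G c → ColouredGraph.graph P ⊑ G
    uncoloured _ (φ , adj-≡ , _) = φ , adj-≡

    same-colour : Edge x u v → ∀ e → x ≡ colour c u v e
    same-colour e e′ = edge-unique e (e′ , refl)

    image-edge : ∀ P (φ : OccursIn P G c) → let open ColouredGraph P in
                 ∀ i j (e : T (adj graph i j)) →
                 Edge (colour colouring i j e) (Injection.to (proj₁ φ) i) (Injection.to (proj₁ φ) j)
    image-edge _ (φ , adj-≡ , colour-≡) i j e = e′ , sym (colour-≡ i j e e′)
      where e′ = subst T (adj-≡ i j) e

  absent⇔ : ∀ p → (¬ OccursIn (pattern-graph p) G c) ⇔ Absent p c
  absent⇔ independent = mk⇔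
    (λ ¬φ {u} {v} {w} u≁v v≁w u≁w → ¬φ (Embedding.embed-coloured 3K₁ G (triple u v w) (monochromatic 3K₁ red) c
      ( (nonadjacent G u≁v ∷ nonadjacent G u≁w ∷ [])
      ∷ (nonadjacent G v≁w ∷ [])
      ∷ [] ∷ [])
      (((λ ()) ∷ (λ ()) ∷ []) ∷ ((λ ()) ∷ []) ∷ [] ∷ [])))
    (λ absent φ → let open Image 3K₁ G (uncoloured ∅3K₁ φ) in
      absent (image-≁ 0F 1F (λ ()) refl) (image-≁ 1F 2F (λ ()) refl) (image-≁ 0F 2F (λ ()) refl))
  absent⇔ (co x) = mk⇔
    (λ ¬φ {u} {v} {w} uv u≁w v≁w → ¬φ (Embedding.embed-coloured coP₃ G (triple u v w) (monochromatic coP₃ x) c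
      ( (adjacent G (proj₁ uv) ∷ nonadjacent G u≁w ∷ [])
      ∷ (nonadjacent G v≁w ∷ [])
      ∷ [] ∷ [])
      (((λ _ → same-colour uv) ∷ (λ ()) ∷ []) ∷ ((λ ()) ∷ []) ∷ [] ∷ [])))
    (λ absent φ → let open Image coP₃ G (uncoloured (pattern-graph (co x)) φ) in
      absent (image-edge (pattern-graph (co x)) φ 0F 1F _) (image-≁ 0F 2F (λ ()) refl) (image-≁ 1F 2F (λ ()) refl))
  absent⇔ (path x) = mk⇔
    (λ ¬φ {u} {v} {w} uv vw u≁w → ¬φ (Embedding.embed-coloured P₃ G (triple u v w) (monochromatic P₃ x) c
      ( (adjacent G (proj₁ uv) ∷ nonadjacent G u≁w ∷ [])
      ∷ (adjacent G (proj₁ vw) ∷ [])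
      ∷ [] ∷ [])
      (((λ _ → same-colour uv) ∷ (λ ()) ∷ []) ∷ ((λ _ → same-colour vw) ∷ []) ∷ [] ∷ [])))
    (λ absent φ → let open Image P₃ G (uncoloured (pattern-graph (path x)) φ) in
      absent (image-edge (pattern-graph (path x)) φ 0F 1F _) (image-edge (pattern-graph (path x)) φ 1F 2F _) (image-≁ 0F 2F (λ ()) refl))
  absent⇔ mixed = mk⇔
    (λ ¬φ {u} {v} {w} uv vw u≁w → ¬φ (Embedding.embed-coloured P₃ G (triple u v w) bicoloured c
      ( (adjacent G (proj₁ uv) ∷ nonadjacent G u≁w ∷ [])
      ∷ (adjacent G (proj₁ vw) ∷ [])
      ∷ [] ∷ [])
      (((λ _ → same-colour uv) ∷ (λ ()) ∷ []) ∷ ((λ _ → same-colour vw) ∷ []) ∷ [] ∷ [])))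
    (λ absent φ → let open Image P₃ G (uncoloured rbP₃ φ) in
      absent (image-edge rbP₃ φ 0F 1F _) (image-edge rbP₃ φ 1F 2F _) (image-≁ 0F 2F (λ ()) refl))

  colourFree⇔ : ∀ ps → ColourFree (map pattern-graph ps) G c ⇔ Avoids ps c
  colourFree⇔ ps = mk⇔
    (λ free → List.map (λ {p} → Equivalence.to (absent⇔ p)) (Listₚ.map⁻ free))
    (λ avoids → Listₚ.map⁺ (List.map (λ {p} → Equivalence.from (absent⇔ p)) avoids))

-- Walks and two-colourings

odd : ℕ → Bool
odd zero    = false
odd (suc n) = not (odd n)

odd-+ : ∀ m n → odd (m + n) ≡ odd m xor odd n
odd-+ zero    n = refl
odd-+ (suc m) n = trans (cong not (odd-+ m n)) (not-distribˡ-xor (odd m) (odd n))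

xor-true : ∀ b b′ → b xor b′ ≡ true → b ≡ true × b′ ≡ false ⊎ b ≡ false × b′ ≡ true
xor-true true  false _ = inj₁ (refl , refl)
xor-true false true  _ = inj₂ (refl , refl)

xor-cancelʳ : ∀ b b′ s → b xor s ≡ b′ xor s → b ≡ b′
xor-cancelʳ true  true  _     _  = refl
xor-cancelʳ false false _     _  = refl
xor-cancelʳ true  false true  ()
xor-cancelʳ true  false false ()
xor-cancelʳ false true  true  ()
xor-cancelʳ false true  false ()

module Walks {V : Set} (R : V → V → Set) (R-sym : Symmetric R) where

  data Walk : ℕ → V → V → Set where
    []  : Walk 0 v v
    _∷_ : R u v → Walk k v w → Walk (suc k) u w

  _++ʷ_ : Walk m u v → Walk n v w → Walk (m + n) u w
  []      ++ʷ q = q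
  (r ∷ p) ++ʷ q = r ∷ (p ++ʷ q)

  snoc : Walk k u v → R v w → Walk (suc k) u w
  snoc []      s = s ∷ []
  snoc (r ∷ p) s = r ∷ snoc p s

  reverse : Walk k u v → Walk k v u
  reverse []      = []
  reverse (r ∷ p) = snoc (reverse p) (R-sym r)

  Linked : Bool → V → V → Set
  Linked b u v = ∃[ k ] odd k ≡ b × Walk k u v

  linked-edge : R u v → Linked true u v
  linked-edge r = 1 , refl , r ∷ []

  linked-sym : Linked b u v → Linked b v u
  linked-sym (k , odd≡ , p) = k , odd≡ , reverse p

  linked-trans : Linked b u v → Linked b′ v w → Linked (b xor b′) u w
  linked-trans (k , refl , p) (l , refl , q) = k + l , odd-+ k l , p ++ʷ q

  at : Walk k u v → ℕ → V
  at {u = u} []      _       = u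
  at {u = u} (r ∷ p) zero    = u
  at         (r ∷ p) (suc i) = at p i

  at-start : (p : Walk k u v) → at p 0 ≡ u
  at-start []      = refl
  at-start (r ∷ p) = refl

  at-end : (p : Walk k u v) → at p k ≡ v
  at-end []      = refl
  at-end (r ∷ p) = at-end p

  at-step : (p : Walk k u v) → ∀ {i} → i < k → R (at p i) (at p (suc i))
  at-step (r ∷ p) {zero}  _         = subst (R _) (sym (at-start p)) r
  at-step (r ∷ p) {suc i} (s≤s i<k) = at-step p i<k

-- A closed walk is read cyclically, so that stretches of it may run past the starting point.
module Loop {V : Set} {R : V → V → Set} (R-sym : Symmetric R)
            {v : V} (p : Walks.Walk R R-sym (suc k) v v) where
  open Walks R R-sym

  loop : ℕ → V
  loop i = at p (i % suc k)

  loop-step : ∀ i → R (loop i) (loop (suc i))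
  loop-step i = subst (λ z → R (loop i) z) (sym next) (at-step p (m%n<n i (suc k)))
    where
    r = i % suc k
    suc-% : suc i % suc k ≡ suc r % suc k
    suc-% = trans (cong (λ z → suc z % suc k) (m≡m%n+[m/n]*n i (suc k)))
                  ([m+kn]%n≡m%n (suc r) (i / suc k) (suc k))
    next : loop (suc i) ≡ at p (suc r)
    next with m≤n⇒m<n∨m≡n (m%n<n i (suc k))
    ... | inj₁ r+1<k+1 = cong (at p) (trans suc-% (m<n⇒m%n≡m r+1<k+1))
    -- At the last position the index wraps to 0, and closedness identifies the two ends.
    ... | inj₂ r+1≡k+1 = begin
      at p (suc i % suc k) ≡⟨ cong (at p) (trans suc-% (trans (cong (_% suc k) r+1≡k+1) (n%n≡0 (suc k)))) ⟩
      at p 0               ≡⟨ at-start p ⟩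
      v                    ≡⟨ at-end p ⟨
      at p (suc k)         ≡⟨ cong (at p) r+1≡k+1 ⟨
      at p (suc r)         ∎
      where open ≡-Reasoning

  loop-period : ∀ i → loop (i + suc k) ≡ loop i
  loop-period i = cong (at p) ([m+n]%n≡m%n i (suc k))

  segment : ∀ d i → Walk d (loop i) (loop (d + i))
  segment zero    i = []
  segment (suc d) i =
    loop-step i ∷ subst (λ j → Walk d (loop (suc i)) (loop j)) (+-suc d i) (segment d (suc i))

-- The constructive half of König's criterion for bipartiteness: edges are inserted one at a time
-- into a forest whose vertices carry their parity relative to the root.
module TwoColouring {R : Fin n → Fin n → Set} (R? : Decidable R) (R-sym : Symmetric R)
                    (no-odd : ∀ {v} → ¬ Walks.Linked R R-sym true v v) where
  open Walks R R-sym

  -- A spanning forest under construction: side v is the parity of some walk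
  -- from v to the root of its tree.
  record Forest : Set where
    field
      root   : Fin n → Fin n
      side   : Fin n → Bool
      linked : ∀ v → Linked (side v) v (root v)

  open Forest

  -- Different sides alone would not survive a later merge, which may flip one end only. With a
  -- common root, both ends are flipped or neither is.
  Separates : Forest → Fin n → Fin n → Set
  Separates F u v = root F u ≡ root F v × side F u ≢ side F v

  discrete : Forest
  discrete = record { root = id ; side = const false ; linked = λ v → 0 , refl , [] }

  merge : (F : Forest) → ∀ {u v} → R u v → root F u ≢ root F v →
          Σ[ F′ ∈ Forest ] Separates F′ u v × (∀ {w z} → Separates F w z → Separates F′ w z)
  merge F {u} {v} r u≢v = F′ , separates , preserves
    where
    -- The parity of the walk from the old root down to `v`, across the new edge and up to the root
    -- of `u`.
    shift : Bool
    shift = side F v xor (true xor side F u)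

    root′ : Fin n → Fin n
    root′ w = if does (root F w ≟ root F v) then root F u else root F w

    side′ : Fin n → Bool
    side′ w = if does (root F w ≟ root F v) then side F w xor shift else side F w

    linked′ : ∀ w → Linked (side′ w) w (root′ w)
    linked′ w with root F w ≟ root F v
    ... | no _      = linked F w
    ... | yes rw≡rv = linked-trans (linked F w)
      (linked-trans (linked-sym (subst (Linked _ v) (sym rw≡rv) (linked F v)))
        (linked-trans (linked-edge (R-sym r)) (linked F u)))

    F′ : Forest
    F′ = record { root = root′ ; side = side′ ; linked = linked′ }

    sides : ∀ b b′ → b ≢ b′ xor (b′ xor not b)
    sides true  true  ()
    sides true  false ()
    sides false true  ()
    sides false false ()

    separates : Separates F′ u v
    separates with root F u ≟ root F v | root F v ≟ root F v
    ... | yes u≡v | _       = contradiction u≡v u≢v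
    ... | no _    | yes _   = refl , sides (side F u) (side F v)
    ... | no _    | no v≢v  = contradiction refl v≢v

    preserves : ∀ {w z} → Separates F w z → Separates F′ w z
    preserves {w} {z} (rw≡rz , sw≢sz) with root F w ≟ root F v | root F z ≟ root F v
    ... | yes _     | yes _     = refl , sw≢sz ∘ xor-cancelʳ _ _ shift
    ... | no _      | no _      = rw≡rz , sw≢sz
    ... | yes rw≡rv | no rz≢rv  = contradiction (trans (sym rw≡rz) rw≡rv) rz≢rv
    ... | no rw≢rv  | yes rz≡rv = contradiction (trans rw≡rz rz≡rv) rw≢rv

  insert : (F : Forest) → ∀ {u v} → R u v →
           Σ[ F′ ∈ Forest ] Separates F′ u v × (∀ {w z} → Separates F w z → Separates F′ w z)
  insert F {u} {v} r with root F u ≟ root F v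
  ... | no u≢v  = merge F r u≢v
  ... | yes u≡v = F , (u≡v , su≢sv) , id
    where
    su≢sv : side F u ≢ side F v
    -- With equal sides, the edge to `v`, the walk up to the common root and the walk down to `u`
    -- would close up with odd length.
    su≢sv su≡sv = no-odd (subst (λ b → Linked b u u) odd-parity
      (linked-trans (linked-edge r) (linked-trans (linked F v)
        (linked-sym (subst (Linked _ u) u≡v (linked F u))))))
      where
      odd-parity : true xor (side F v xor side F u) ≡ true
      odd-parity = cong not (trans (cong (side F v xor_) su≡sv) (xor-same (side F v)))

  build : (es : List (Fin n × Fin n)) →
          Σ[ F ∈ Forest ] List.All (λ (u , v) → R u v → Separates F u v) es
  build []             = discrete , []
  build ((u , v) ∷ es) with build es | R? u v
  ... | F , separated | no ¬r = F , (λ r → contradiction r ¬r) ∷ separated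
  ... | F , separated | yes r with insert F r
  ...   | F′ , new , preserves = F′ , (λ _ → new) ∷ List.map (preserves ∘_) separated

  two-colouring : Σ[ f ∈ (Fin n → Bool) ] (∀ u v → R u v → f u ≢ f v)
  two-colouring with build (cartesianProduct (allFin n) (allFin n))
  ... | F , separated = side F , λ u v r →
    proj₂ (List.lookup separated (∈-cartesianProduct⁺ (∈-allFin u) (∈-allFin v)) r)

complement-~⇔≁ : (G : Graph (Fin n)) → ∀ {u v} →
                 T (adj (complement G) u v) ⇔ Adjacency._≁_ G u v
complement-~⇔≁ G {u} {v} with u ≟ v | adj G u v
... | yes u≡v | _     = mk⇔ ⊥-elim (λ (u≢v , _) → contradiction u≡v u≢v)
... | no u≢v  | true  = mk⇔ ⊥-elim (λ (_ , ¬⊤) → ¬⊤ _)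
... | no u≢v  | false = mk⇔ (λ _ → u≢v , id) _

-- Co-bipartiteness from the absence of `3K₁` and of monochromatic induced `P₃`

module _ {G : Graph (Fin n)} (c : Colouring G)
         (no3K₁ : Adjacency.No3K₁ G) (noMono : ColouredEdges.NoMonochromaticP₃ c) where
  open FiniteAdjacency G
  open ColouredEdges c
  open Walks _≁_ ≁-sym

  -- A shortest odd closed walk ω in the complement, of length 4 + m ≥ 5, has no
  -- chords.  Hence G joins ω i to ω (2 + e + i) whenever e ≤ m, and the colour
  -- of this edge flips when either endpoint moves one step along the walk.
  module ShortestOddCycle {m} (odd-m : odd m ≡ true)
      (shorter : ∀ {l} → l < 4 + m → odd l ≡ true → ∀ {v} → ¬ Walk l v v)
      {v} (p : Walk (4 + m) v v) where
    open Loop ≁-sym p renaming (loop to ω)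

    -- The rest of the way round: the lengths `2 + e` and `2 + e′` of the two arcs add up to
    -- `4 + m`.
    complementary-arc : ∀ e e′ → e + e′ ≡ m → ∀ i → Walk (2 + e′) (ω (2 + e + i)) (ω i)
    complementary-arc e e′ refl i =
      subst (Walk _ _) (trans (cong ω length≡) (loop-period i)) (segment (2 + e′) (2 + e + i))
      where
      length≡ : 2 + e′ + (2 + e + i) ≡ i + (4 + (e + e′))
      length≡ = begin
        2 + (e′ + (2 + (e + i))) ≡⟨ cong (2 +_) (trans (+-suc e′ _) (cong suc (+-suc e′ _))) ⟩
        4 + (e′ + (e + i))       ≡⟨ cong (4 +_) (+-comm e′ (e + i)) ⟩
        4 + (e + i + e′)         ≡⟨ cong (λ z → 4 + (z + e′)) (+-comm e i) ⟩
        4 + (i + e + e′)         ≡⟨ cong (4 +_) (+-assoc i e e′) ⟩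
        4 + (i + (e + e′))       ≡⟨ cong (4 +_) (+-comm i (e + e′)) ⟩
        4 + (e + e′) + i         ≡⟨ +-comm (4 + (e + e′)) i ⟩
        i + (4 + (e + e′))       ∎
        where open ≡-Reasoning

    -- The two arcs between the vertices have opposite parities. If the vertices coincided, the odd
    -- arc would be a shorter odd closed walk; if they were non-adjacent, the even arc closed by
    -- that one step would be.
    chord : ∀ e e′ → e + e′ ≡ m → ∀ i → ω i ~ ω (2 + e + i)
    chord e e′ refl i
      with trichotomous (ω i) (ω (2 + e + i)) | xor-true (odd e) (odd e′) (trans (sym (odd-+ e e′)) odd-m)
    ... | inj₂ (inj₁ adjacent) | _ = adjacent
    ... | inj₁ eq | inj₁ (odd-e , _) =
      ⊥-elim (shorter (s≤s (s≤s (s≤s (m≤n⇒m≤1+n (m≤m+n e e′))))) (trans (not-involutive _) odd-e)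
        (subst (Walk _ (ω i)) (sym eq) (segment (2 + e) i)))
    ... | inj₁ eq | inj₂ (_ , odd-e′) =
      ⊥-elim (shorter (s≤s (s≤s (s≤s (m≤n⇒m≤1+n (m≤n+m e′ e))))) (trans (not-involutive _) odd-e′)
        (subst (λ z → Walk _ z (ω i)) (sym eq) (complementary-arc e e′ refl i)))
    ... | inj₂ (inj₂ far) | inj₁ (_ , even-e′) =
      ⊥-elim (shorter (s≤s (s≤s (s≤s (s≤s (m≤n+m e′ e))))) (cong not (trans (not-involutive _) even-e′))
        (far ∷ complementary-arc e e′ refl i))
    ... | inj₂ (inj₂ far) | inj₂ (even-e , _) =
      ⊥-elim (shorter (s≤s (s≤s (s≤s (s≤s (m≤m+n e e′))))) (cong not (trans (not-involutive _) even-e))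
        (≁-sym far ∷ segment (2 + e) i))

    Chord : Colour → ℕ → ℕ → Set
    Chord x e i = Edge x (ω i) (ω (2 + e + i))

    -- The old and the new end are consecutive on `ω`, hence non-adjacent, and both are joined to
    -- `ω i`. Equal colours would give a monochromatic induced `P₃` centred at `ω i`.
    advance-end : ∀ e e′ → suc e + e′ ≡ m → ∀ i → Chord x e i → Chord (other x) (suc e) i
    advance-end {x} e e′ eq i xe with edge-cases x (chord (suc e) e′ eq i)
    ... | inj₂ ye′ = ye′
    ... | inj₁ xe′ = contradiction (loop-step (2 + e + i)) (noMono x (edge-sym xe) xe′)

    advance-start : ∀ e e′ → suc e + e′ ≡ m → ∀ i → Chord x (suc e) i → Chord (other x) e (suc i)
    advance-start {x} e e′ eq i xe with edge-cases x (chord e (suc e′) (trans (+-suc e e′) eq) (suc i))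
    ... | inj₂ ye′ = ye′
    ... | inj₁ xe′ = contradiction (loop-step i)
      (noMono x xe (edge-sym (subst (λ j → Edge x (ω (suc i)) (ω (2 + j))) (+-suc e i) xe′)))

    rotate : ∀ i → Chord x 0 0 → Chord x 0 i
    rotate zero    xe = xe
    rotate {x} (suc i) xe = rotate-once m refl odd-m
      where
      rotate-once : ∀ l → l ≡ m → odd l ≡ true → Chord x 0 (suc i)
      rotate-once (suc l) eq _ =
        subst (λ z → Chord z 0 (suc i)) (other-involutive x)
          (advance-start 0 l eq i (advance-end 0 l eq i (rotate i xe)))

    alternate : ∀ e e′ → e + e′ ≡ m → Chord x 0 0 → Chord (if odd e then other x else x) e 0
    alternate zero    e′ eq xe = xe
    alternate {x} (suc e) e′ eq xe with odd e | alternate e (suc e′) (trans (+-suc e e′) eq) xe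
    ... | true  | ye = subst (λ z → Chord z (suc e) 0) (other-involutive x) (advance-end e e′ eq 0 ye)
    ... | false | ye = advance-end e e′ eq 0 ye

    -- Since `ω` has period `4 + m`, the chord from `ω 0` to `ω (2 + m)` is also the chord of span 2
    -- that starts at `ω (2 + m)`. Rotation gives it the colour of the first chord of span 2,
    -- whereas lengthening that chord `m` times flips its colour an odd number of times.
    impossible : ⊥
    impossible with edge (chord 0 m refl 0)
    ... | x , xe = contradiction (edge-unique first last) (≢-other x)
      where
      last : Edge (other x) (ω 0) (ω (2 + m))
      last = subst₂ (λ b j → Edge (if b then other x else x) (ω 0) (ω (2 + j))) odd-m (+-identityʳ m)
               (alternate m 0 (+-identityʳ m) xe)
      first : Edge x (ω 0) (ω (2 + m))
      first = edge-sym (subst (Edge x _) (loop-period 0) (rotate (2 + m) xe))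

  -- Length 1 contradicts irreflexivity and length 3 is a `3K₁`. For every longer odd closed walk
  -- the induction hypothesis supplies minimality.
  no-odd-closed-walk : ∀ k → odd k ≡ true → ∀ {v} → ¬ Walk k v v
  no-odd-closed-walk = <-rec _ λ
    { 1 _ _ (r ∷ []) → proj₁ r refl
    ; 3 _ _ (r ∷ s ∷ t ∷ []) → no3K₁ r s (≁-sym t)
    ; (suc (suc (suc (suc m)))) rec odd-k p → ShortestOddCycle.impossible
        (trans (sym (trans (not-involutive _) (not-involutive _))) odd-k)
        (λ l<k → rec l<k) p
    }

  complement-bipartite : CoBipartite G
  complement-bipartite with TwoColouring.two-colouring _≁?_ ≁-sym
                      (λ (k , odd-k , p) → no-odd-closed-walk k odd-k p)
  ... | f , proper = side , λ u v u~v sides≡ →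
    proper u v (Equivalence.to (complement-~⇔≁ G) u~v) (side-injective (f u) (f v) sides≡)
    where
    toFin : Bool → Fin 2
    toFin false = 0F
    toFin true  = 1F
    side = toFin ∘ f
    side-injective : ∀ b b′ → toFin b ≡ toFin b′ → b ≡ b′
    side-injective true  true  _ = refl
    side-injective false false _ = refl

-- Partitions

least : {P : Fin n → Set} → Unary.Decidable P → ∃ P → ∃[ i ] P i × (∀ j → j Fin.< i → ¬ P j)
least {suc n} P? p with P? 0F
least {suc n} P? p             | yes p₀ = 0F , p₀ , λ _ ()
least {suc n} P? (0F    , p₀)  | no ¬p₀ = contradiction p₀ ¬p₀
least {suc n} P? (suc i , pᵢ)  | no ¬p₀ with least (P? ∘ suc) (i , pᵢ)
... | j , pⱼ , minimal = suc j , pⱼ , λ { 0F _ → ¬p₀ ; (suc l) (s≤s l<j) → minimal l l<j }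

-- Least elements serve as canonical representatives. They turn a decidable equivalence into a map
-- to `Fin n` whose fibres are its classes, the form of partition that `DisjointUnionOf` and
-- `JoinOf` ask for.
module Classes {E : Fin n → Fin n → Set} (E? : Decidable E) (isEquivalence : IsEquivalence E) where
  open IsEquivalence isEquivalence renaming (refl to E-refl; sym to E-sym; trans to E-trans)

  private
    leastRelated : ∀ u → ∃[ v ] E u v × (∀ w → w Fin.< v → ¬ E u w)
    leastRelated u = least (E? u) (u , E-refl)

  class : Fin n → Fin n
  class u = proj₁ (leastRelated u)

  class-related : ∀ u → E u (class u)
  class-related u = proj₁ (proj₂ (leastRelated u))

  related⇒≡ : ∀ {u v} → E u v → class u ≡ class v
  related⇒≡ {u} {v} e with <-cmp (class u) (class v)
  ... | tri< u<v _ _ = contradiction (E-trans (E-sym e) (class-related u))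
                         (proj₂ (proj₂ (leastRelated v)) _ u<v)
  ... | tri≈ _ u≡v _ = u≡v
  ... | tri> _ _ v<u = contradiction (E-trans e (class-related v))
                         (proj₂ (proj₂ (leastRelated u)) _ v<u)

  ≡⇒related : ∀ {u v} → class u ≡ class v → E u v
  ≡⇒related {u} {v} eq = E-trans (class-related u) (subst (λ z → E z v) (sym eq) (E-sym (class-related v)))

Fibre : (V → Fin k) → Fin k → Set
Fibre part i = Σ[ v ∈ _ ] part v ≡ i

-- The second component is an equation in `Fin k` and therefore unique.
fibre-≡ : {part : V → Fin k} {i : Fin k} {a b : Fibre part i} → proj₁ a ≡ proj₁ b → a ≡ b
fibre-≡ {a = v , p} {b = _ , q} refl = cong (v ,_) (Decidable⇒UIP.≡-irrelevant _≟_ p q)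

fibreGraph : Graph V → (part : V → Fin k) → (i : Fin k) → Graph (Fibre part i)
fibreGraph G part i = induce G proj₁

three-in-two : (a b c : Fin 2) → a ≢ b → b ≢ c → a ≢ c → ⊥
three-in-two 0F 0F _  a≢b _   _   = a≢b refl
three-in-two 1F 1F _  a≢b _   _   = a≢b refl
three-in-two 0F 1F 0F _   _   a≢c = a≢c refl
three-in-two 0F 1F 1F _   b≢c _   = b≢c refl
three-in-two 1F 0F 0F _   b≢c _   = b≢c refl
three-in-two 1F 0F 1F _   _   a≢c = a≢c refl

module _ (G : Graph V) {part : V → Fin k}
         (separate : ∀ u v → part u ≢ part v → ¬ Graph._~_ G u v)
         (complete : ∀ i → Complete (fibreGraph G part i)) where
  open Adjacency G

  ~⇒same-part : u ~ v → part u ≡ part v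
  ~⇒same-part {u} {v} u~v with part u ≟ part v
  ... | yes eq = eq
  ... | no neq = contradiction u~v (separate u v neq)

  ≁⇒different-part : u ≁ v → part u ≢ part v
  ≁⇒different-part {u} {v} (u≢v , ¬u~v) eq =
    ¬u~v (complete (part v) (u , eq) (v , refl) (u≢v ∘ cong proj₁))

cluster⇒noP₃ : (G : Graph V) → Cluster G → Adjacency.NoP₃ G
cluster⇒noP₃ G (_ , _ , separate , complete) u~v v~w u≁w =
  ≁⇒different-part G separate complete u≁w
    (trans (~⇒same-part G separate complete u~v) (~⇒same-part G separate complete v~w))

twoCliques⇒cluster : (G : Graph V) → AtMostTwoCliques G → Cluster G
twoCliques⇒cluster G (k , _ , cliques) = k , cliques

twoCliques⇒no3K₁ : (G : Graph V) → AtMostTwoCliques G → Adjacency.No3K₁ G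
twoCliques⇒no3K₁ G (_ , k≤2 , part , separate , complete) u≁v v≁w u≁w =
  three-in-two _ _ _ (≢-in-2 u≁v) (≢-in-2 v≁w) (≢-in-2 u≁w)
  where
  open Adjacency G
  ≢-in-2 : u ≁ v → inject≤ (part u) k≤2 ≢ inject≤ (part v) k≤2
  ≢-in-2 u≁v = ≁⇒different-part G separate complete u≁v ∘ inject≤-injective k≤2 k≤2 _ _

-- The map `h` lets the classes be computed in an ambient `Fin n` when the vertices of `G` are only
-- a fibre of it.
equivalence⇒cluster :
  (G : Graph W) (h : W → Fin n) {E : Fin n → Fin n → Set} → Decidable E → IsEquivalence E →
  (∀ {a b} → Graph._~_ G a b → E (h a) (h b)) →
  (∀ {a b} → E (h a) (h b) → a ≡ b ⊎ Graph._~_ G a b) →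
  Cluster G
equivalence⇒cluster G h E? isEquivalence ~⇒E E⇒≡⊎~ =
  _ , class ∘ h , (λ a b a≢b a~b → a≢b (related⇒≡ (~⇒E a~b))) ,
  λ { i (a , a∈i) (b , b∈i) a≢b →
        [ (λ a≡b → contradiction (fibre-≡ a≡b) a≢b) , id ]′
          (E⇒≡⊎~ (≡⇒related (trans a∈i (sym b∈i)))) }
  where open Classes E? isEquivalence

-- Being equal or adjacent is transitive where there is no induced `P₃`. Requiring equal parts as
-- well makes it an equivalence on all of `Fin n`, so that one relation serves every fibre.
fibre-cluster : (G : Graph (Fin n)) (part : Fin n → Fin k) → let open Adjacency G in
  (∀ {u v w} → part u ≡ part v → part v ≡ part w → u ~ v → v ~ w → ¬ u ≁ w) →
  ∀ i → Cluster (fibreGraph G part i)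
fibre-cluster {n} G part noP₃ i =
  equivalence⇒cluster (fibreGraph G part i) proj₁ E? isEquivalence
    (λ { {_ , p} {_ , q} u~v → trans p (sym q) , inj₂ u~v })
    (λ { (_ , inj₁ u≡v) → inj₁ (fibre-≡ u≡v) ; (_ , inj₂ u~v) → inj₂ u~v })
  where
  open FiniteAdjacency G
  E : Fin n → Fin n → Set
  E u v = part u ≡ part v × (u ≡ v ⊎ u ~ v)
  E? : Decidable E
  E? u v = part u ≟ part v ×-dec (u ≟ v ⊎-dec u ~? v)
  E-trans : ∀ {u v w} → E u v → E v w → E u w
  E-trans (p , inj₁ refl) (q , s) = q , s
  E-trans (p , inj₂ u~v) (q , inj₁ refl) = p , inj₂ u~v
  E-trans {u} {v} {w} (p , inj₂ u~v) (q , inj₂ v~w) with trichotomous u w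
  ... | inj₁ u≡w        = trans p q , inj₁ u≡w
  ... | inj₂ (inj₁ u~w) = trans p q , inj₂ u~w
  ... | inj₂ (inj₂ u≁w) = ⊥-elim (noP₃ p q u~v v~w u≁w)
  isEquivalence : IsEquivalence E
  isEquivalence = record
    { refl  = refl , inj₁ refl
    ; sym   = λ { (p , inj₁ refl) → p , inj₁ refl ; (p , inj₂ u~v) → sym p , inj₂ (~-sym u~v) }
    ; trans = E-trans
    }

noP₃⇒cluster : (G : Graph (Fin n)) → Adjacency.NoP₃ G → Cluster G
noP₃⇒cluster G noP₃ =
  -- With a single part, the fibre is `G` itself up to a trivial proof attached to each vertex.
  let k , part , separate , complete = fibre-cluster {k = 1} G (λ _ → 0F) (λ _ _ → noP₃) 0F in
  k , part ∘ (_, refl) , (λ u v → separate (u , refl) (v , refl)) ,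
  λ { i (u , p) (v , q) u≢v → complete i ((u , refl) , p) ((v , refl) , q)
        (λ eq → u≢v (fibre-≡ (cong (proj₁ ∘ proj₁) eq))) }

-- For any vertex `r`, the closed neighbourhood of `r` is a clique by `NoP₃`, and its non-neighbours
-- form one by `No3K₁`. Deciding whether a vertex exists provides `r`; without vertices, no parts
-- are used.
anchored⇒twoCliques : (G : Graph W) → let open Adjacency G in
  Trichotomous → NoP₃ → No3K₁ → Dec W → AtMostTwoCliques G
anchored⇒twoCliques G _ _ _ (no empty) =
  0 , z≤n , (λ a → contradiction a empty) , (λ a → contradiction a empty) , λ ()
anchored⇒twoCliques {W} G trichotomous noP₃ no3K₁ (yes r) =
  2 , ≤-refl , side , separate , complete
  where
  open Adjacency G
  sideOf : ∀ a → a ≡ r ⊎ a ~ r ⊎ a ≁ r → Fin 2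
  sideOf a (inj₂ (inj₂ _)) = 1F
  sideOf a _               = 0F
  side : W → Fin 2
  side a = sideOf a (trichotomous a r)
  separate : ∀ a b → side a ≢ side b → ¬ a ~ b
  separate a b a≢b a~b with trichotomous a r | trichotomous b r
  ... | inj₁ _           | inj₁ _           = a≢b refl
  ... | inj₁ _           | inj₂ (inj₁ _)    = a≢b refl
  ... | inj₁ refl        | inj₂ (inj₂ b≁r)  = ~⇒¬≁ (~-sym a~b) b≁r
  ... | inj₂ (inj₁ _)    | inj₁ _           = a≢b refl
  ... | inj₂ (inj₁ _)    | inj₂ (inj₁ _)    = a≢b refl
  ... | inj₂ (inj₁ a~r)  | inj₂ (inj₂ b≁r)  = noP₃ (~-sym a~b) a~r b≁r
  ... | inj₂ (inj₂ a≁r)  | inj₁ refl        = ~⇒¬≁ a~b a≁r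
  ... | inj₂ (inj₂ a≁r)  | inj₂ (inj₁ b~r)  = noP₃ a~b b~r a≁r
  ... | inj₂ (inj₂ _)    | inj₂ (inj₂ _)    = a≢b refl
  same-side : ∀ a b → side a ≡ side b → a ≢ b → a ~ b
  same-side a b eq a≢b with trichotomous a b
  ... | inj₁ a≡b        = contradiction a≡b a≢b
  ... | inj₂ (inj₁ a~b) = a~b
  ... | inj₂ (inj₂ a≁b) with trichotomous a r | trichotomous b r
  ...   | inj₁ refl       | inj₁ refl       = contradiction refl a≢b
  ...   | inj₁ refl       | inj₂ (inj₁ b~r) = ~-sym b~r
  ...   | inj₂ (inj₁ a~r) | inj₁ refl       = a~r
  ...   | inj₂ (inj₁ a~r) | inj₂ (inj₁ b~r) = ⊥-elim (noP₃ a~r (~-sym b~r) a≁b)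
  ...   | inj₂ (inj₂ a≁r) | inj₂ (inj₂ b≁r) = ⊥-elim (no3K₁ a≁r (≁-sym b≁r) a≁b)
  same-side a b () a≢b | inj₂ (inj₂ a≁b) | inj₁ _ | inj₂ (inj₂ _)
  same-side a b () a≢b | inj₂ (inj₂ a≁b) | inj₂ (inj₁ _) | inj₂ (inj₂ _)
  same-side a b () a≢b | inj₂ (inj₂ a≁b) | inj₂ (inj₂ _) | inj₁ _
  same-side a b () a≢b | inj₂ (inj₂ a≁b) | inj₂ (inj₂ _) | inj₂ (inj₁ _)
  complete : ∀ i → Complete (fibreGraph G side i)
  complete i (a , p) (b , q) a≢b = same-side a b (trans p (sym q)) (a≢b ∘ fibre-≡)

noP₃-no3K₁⇒twoCliques : (G : Graph (Fin n)) → let open Adjacency G in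
                        NoP₃ → No3K₁ → AtMostTwoCliques G
noP₃-no3K₁⇒twoCliques {n} G noP₃ no3K₁ =
  anchored⇒twoCliques G trichotomous noP₃ no3K₁ (inhabited? n)
  where
  open FiniteAdjacency G
  inhabited? : ∀ n → Dec (Fin n)
  inhabited? zero    = no λ ()
  inhabited? (suc n) = yes 0F

module _ (G : Graph (Fin n)) (part : Fin n → Fin k) (i : Fin k) where
  private
    H = fibreGraph G part i
    module G = FiniteAdjacency G
    module H = Adjacency H

  lift-≁ : {a b : Fibre part i} → a H.≁ b → proj₁ a G.≁ proj₁ b
  lift-≁ (a≢b , ¬a~b) = a≢b ∘ fibre-≡ , ¬a~b

  fibre-trichotomous : H.Trichotomous
  fibre-trichotomous (u , p) (v , q) with G.trichotomous u v
  ... | inj₁ u≡v               = inj₁ (fibre-≡ u≡v)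
  ... | inj₂ (inj₁ u~v)        = inj₂ (inj₁ u~v)
  ... | inj₂ (inj₂ (u≢v , ¬e)) = inj₂ (inj₂ (u≢v ∘ cong proj₁ , ¬e))

  fibre-inhabited? : Dec (Fibre part i)
  fibre-inhabited? = any? λ v → part v ≟ i

-- Uncoloured characterisations

module _ {G : Graph V} where
  open Adjacency G

  ≁⇒same-part : {part : V → Fin k} → (∀ u v → part u ≢ part v → u ~ v) → u ≁ v → part u ≡ part v
  ≁⇒same-part {u = u} {v} {part} join (_ , ¬u~v) = decidable-stable (part u ≟ part v) (¬u~v ∘ join u v)

  completeMultipartite⇒noCoP₃ : CompleteMultipartite G → NoCoP₃
  completeMultipartite⇒noCoP₃ (_ , part , join , edgeless) {u} {v} {w} u~v u≁w v≁w =
    edgeless (part w) (u , ≁⇒same-part join u≁w) (v , ≁⇒same-part join v≁w) u~v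

  completeMinusMatching⇒matched : CompleteMinusMatching G → u ≁ v → u ≁ w → v ≡ w
  completeMinusMatching⇒matched (M , matching , G⇔) u≁v u≁w =
    matching _ _ _ (matched u≁v) (matched u≁w)
    where
    matched : u ≁ v → Graph._~_ M u v
    matched (u≢v , ¬u~v) = decidable-stable (T? _) λ ¬uMv → ¬u~v (Equivalence.from (G⇔ _ _) (u≢v , ¬uMv))

  completeMinusMatching⇒no3K₁ : CompleteMinusMatching G → No3K₁
  completeMinusMatching⇒no3K₁ cmm u≁v v≁w u≁w =
    proj₁ v≁w (completeMinusMatching⇒matched cmm u≁v u≁w)

  completeMinusMatching⇒noCoP₃ : CompleteMinusMatching G → NoCoP₃
  completeMinusMatching⇒noCoP₃ cmm u~v u≁w v≁w =
    ~⇒≢ u~v (completeMinusMatching⇒matched cmm (≁-sym u≁w) (≁-sym v≁w))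

  join⇒noP₃-in-parts : {part : V → Fin k} → (∀ i → Cluster (fibreGraph G part i)) →
    part u ≡ part v → part v ≡ part w → u ~ v → v ~ w → ¬ u ≁ w
  join⇒noP₃-in-parts isCluster u≡v v≡w u~v v~w (u≢w , ¬u~w) =
    cluster⇒noP₃ (fibreGraph G _ _) (isCluster _) {_ , trans u≡v v≡w} {_ , v≡w} {_ , refl}
      u~v v~w (u≢w ∘ cong proj₁ , ¬u~w)

≅2K₁⇒edgeless : (G : Graph V) → G ≅ 2K₁ → Edgeless G
≅2K₁⇒edgeless G (φ , adj-≡) u v u~v = no-edges (to u) (to v) (subst T (adj-≡ u v) u~v)
  where
  open Inverse φ
  no-edges : ∀ i j → ¬ T (adj 2K₁ i j)
  no-edges 0F 0F ()
  no-edges 0F 1F ()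
  no-edges 1F 0F ()
  no-edges 1F 1F ()

≅2K₁⇒no3K₁ : (G : Graph V) → G ≅ 2K₁ → Adjacency.No3K₁ G
≅2K₁⇒no3K₁ G (φ , _) (u≢v , _) (v≢w , _) (u≢w , _) =
  three-in-two _ _ _ (u≢v ∘ injective) (v≢w ∘ injective) (u≢w ∘ injective)
  where open Injection (↔⇒↣ φ) using (injective)

module _ (G : Graph (Fin n)) where
  open FiniteAdjacency G

  Triple : Set
  Triple = ∃[ u ] ∃[ v ] ∃[ w ] u ≁ v × v ≁ w × u ≁ w

  triple? : Dec Triple
  triple? = any? λ u → any? λ v → any? λ w → u ≁? v ×-dec v ≁? w ×-dec u ≁? w

  ¬triple⇒no3K₁ : ¬ Triple → No3K₁
  ¬triple⇒no3K₁ ¬triple u≁v v≁w u≁w = ¬triple (_ , _ , _ , u≁v , v≁w , u≁w)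

  -- Absence of `coP₃` is transitivity of non-adjacency, whose classes are the parts.
  noCoP₃⇒completeMultipartite : NoCoP₃ → CompleteMultipartite G
  noCoP₃⇒completeMultipartite noCoP₃ =
    n , class ,
    (λ u v differ → decidable-stable (u ~? v) (differ ∘ related⇒≡)) ,
    λ { i (u , p) (v , q) → ≡⇒related (trans p (sym q)) }
    where
    ¬~-trans : ∀ {u v w} → ¬ u ~ v → ¬ v ~ w → ¬ u ~ w
    ¬~-trans {u} {v} {w} ¬u~v ¬v~w u~w =
      noCoP₃ u~w ((λ { refl → ¬v~w u~w }) , ¬u~v) ((λ { refl → ¬u~v u~w }) , ¬v~w ∘ ~-sym)
    ¬~? : Decidable (λ u v → ¬ u ~ v)
    ¬~? u v = ¬? (u ~? v)
    ¬~-isEquivalence : IsEquivalence (λ u v → ¬ u ~ v)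
    ¬~-isEquivalence = record
      { refl  = ~-irrefl
      ; sym   = λ ¬u~v → ¬u~v ∘ ~-sym
      ; trans = ¬~-trans
      }
    open Classes ¬~? ¬~-isEquivalence

  -- The complement is the matching: two distinct non-neighbours of one vertex would form a `coP₃`
  -- or a `3K₁` with it.
  noCoP₃-no3K₁⇒completeMinusMatching : NoCoP₃ → No3K₁ → CompleteMinusMatching G
  noCoP₃-no3K₁⇒completeMinusMatching noCoP₃ no3K₁ =
    complement G ,
    (λ u v w u≁v u≁w → matched (Equivalence.to (complement-~⇔≁ G) u≁v) (Equivalence.to (complement-~⇔≁ G) u≁w)) ,
    λ u v → mk⇔
      (λ u~v → ~⇒≢ u~v , ~⇒¬≁ u~v ∘ Equivalence.to (complement-~⇔≁ G))
      (λ (u≢v , ¬u≁v) → ≢-¬≁⇒~ u≢v (¬u≁v ∘ Equivalence.from (complement-~⇔≁ G)))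
    where
    matched : ∀ {u v w} → u ≁ v → u ≁ w → v ≡ w
    matched {u} {v} {w} u≁v u≁w with trichotomous v w
    ... | inj₁ v≡w        = v≡w
    ... | inj₂ (inj₁ v~w) = ⊥-elim (noCoP₃ v~w (≁-sym u≁v) (≁-sym u≁w))
    ... | inj₂ (inj₂ v≁w) = ⊥-elim (no3K₁ u≁v v≁w u≁w)

  -- One edge `u v` spreads everywhere. A vertex far from `u` completes it to a `P₃` or a `coP₃`, so
  -- all vertices are joined to `u`, and then to each other by `NoP₃`.
  noCoP₃-noP₃⇒edgeless⊎complete : NoCoP₃ → NoP₃ → Edgeless G ⊎ Complete G
  noCoP₃-noP₃⇒edgeless⊎complete noCoP₃ noP₃ with any? (λ u → any? (λ v → u ~? v))
  ... | no ¬edge          = inj₁ λ u v u~v → ¬edge (u , v , u~v)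
  ... | yes (u , v , u~v) = inj₂ complete
    where
    near-u : ∀ w → w ≢ u → w ~ u
    near-u w w≢u with trichotomous w u | trichotomous w v
    ... | inj₁ w≡u        | _               = contradiction w≡u w≢u
    ... | inj₂ (inj₁ w~u) | _               = w~u
    ... | inj₂ (inj₂ w≁u) | inj₁ refl       = ~-sym u~v
    ... | inj₂ (inj₂ w≁u) | inj₂ (inj₁ w~v) = ⊥-elim (noP₃ w~v (~-sym u~v) w≁u)
    ... | inj₂ (inj₂ w≁u) | inj₂ (inj₂ w≁v) = ⊥-elim (noCoP₃ u~v (≁-sym w≁u) (≁-sym w≁v))
    complete : Complete G
    complete w z w≢z with w ≟ u | z ≟ u
    ... | yes refl | _        = ~-sym (near-u z (≢-sym w≢z))
    ... | no w≢u   | yes refl = near-u w w≢u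
    ... | no w≢u   | no z≢u   = ≢-¬≁⇒~ w≢z (noP₃ (near-u w w≢u) (~-sym (near-u z z≢u)))

edgeless-no3K₁⇒complete⊎2K₁ : (G : Graph (Fin n)) → Edgeless G → Adjacency.No3K₁ G →
                              Complete G ⊎ G ≅ 2K₁
edgeless-no3K₁⇒complete⊎2K₁ {0} G _ _ = inj₁ λ ()
edgeless-no3K₁⇒complete⊎2K₁ {1} G _ _ = inj₁ λ { 0F 0F 0≢0 → contradiction refl 0≢0 }
edgeless-no3K₁⇒complete⊎2K₁ {2} G edgeless _ = inj₂ (mk↔ₛ′ id id (λ _ → refl) (λ _ → refl) , adj-≡)
  where
  ¬T⇒≡false : ¬ T b → b ≡ false
  ¬T⇒≡false {false} _  = refl
  ¬T⇒≡false {true}  ¬t = contradiction _ ¬t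
  adj-≡ : ∀ u v → adj G u v ≡ adj 2K₁ u v
  adj-≡ u v = trans (¬T⇒≡false (edgeless u v)) (sym (no-edges u v))
    where
    no-edges : ∀ i j → adj 2K₁ i j ≡ false
    no-edges 0F 0F = refl
    no-edges 0F 1F = refl
    no-edges 1F 0F = refl
    no-edges 1F 1F = refl
edgeless-no3K₁⇒complete⊎2K₁ {suc (suc (suc _))} G edgeless no3K₁ =
  ⊥-elim (no3K₁ {0F} {1F} {2F} ((λ ()) , edgeless _ _) ((λ ()) , edgeless _ _) ((λ ()) , edgeless _ _))

-- Consequences of avoiding coloured patterns

module _ {G : Graph V} (c : Colouring G) where
  open Adjacency G
  open ColouredEdges c

  noMonochromaticP₃ : Absent (path red) c → Absent (path blue) c → NoMonochromaticP₃
  noMonochromaticP₃ = both-colours {λ x → Absent (path x) c}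

  noCoP₃ : Absent (co red) c → Absent (co blue) c → NoCoP₃
  noCoP₃ r b u~v = both-colours {λ x → Absent (co x) c} r b _ (proj₂ (edge u~v))

  -- Reading the path backwards exchanges its colours.
  mixed-absent : Absent mixed c → ∀ x → Edge x u v → Edge (other x) v w → ¬ u ≁ w
  mixed-absent absent red  uv vw u≁w = absent uv vw u≁w
  mixed-absent absent blue uv vw u≁w = absent (edge-sym vw) (edge-sym uv) (≁-sym u≁w)

  noP₃ : Absent (path red) c → Absent (path blue) c → Absent mixed c → NoP₃
  noP₃ r b absent u~v v~w u≁w with edge u~v
  ... | x , uv with edge-cases x v~w
  ...   | inj₁ vw = noMonochromaticP₃ r b x uv vw u≁w
  ...   | inj₂ vw = mixed-absent absent x uv vw u≁w

  -- Two of the three edges from v have the same colour.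
  noMonochromaticP₃⇒noClaw : NoMonochromaticP₃ → ∀ {v a b d} → v ~ a → v ~ b → v ~ d →
                             a ≁ b → b ≁ d → a ≁ d → ⊥
  noMonochromaticP₃⇒noClaw noMono v~a v~b v~d a≁b b≁d a≁d with edge v~a
  ... | x , va with edge-cases x v~b | edge-cases x v~d
  ...   | inj₁ vb | _       = noMono x (edge-sym va) vb a≁b
  ...   | inj₂ vb | inj₁ vd = noMono x (edge-sym va) vd a≁d
  ...   | inj₂ vb | inj₂ vd = noMono (other x) (edge-sym vb) vd b≁d

  forced-edge : Absent (co x) c → u ~ v → u ≁ w → v ≁ w → Edge (other x) u v
  forced-edge {x} absent u~v u≁w v≁w with edge-cases x u~v
  ... | inj₁ uv = ⊥-elim (absent uv u≁w v≁w)
  ... | inj₂ uv = uv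

  -- The isolated vertex is a common non-neighbour for both edges of the path.
  noK₁+P₃ : Absent (co x) c → Absent (path (other x)) c → NoK₁+P₃
  noK₁+P₃ co-absent path-absent t≁u t≁v t≁w u~v v~w u≁w = path-absent
    (forced-edge co-absent u~v (≁-sym t≁u) (≁-sym t≁v))
    (forced-edge co-absent v~w (≁-sym t≁v) (≁-sym t≁w)) u≁w

  -- In `C₅` the vertex opposite an edge is non-adjacent to both its ends, so two consecutive edges
  -- are forced to the same colour.
  noC₅ : Absent (co x) c → Absent (path (other x)) c → NoC₅
  noC₅ co-absent path-absent p~q q~r r~s s~t t~p p≁r p≁s q≁s q≁t r≁t = path-absent
    (forced-edge co-absent p~q p≁s q≁s)
    (forced-edge co-absent q~r q≁t r≁t) p≁r

module _ {G : Graph (Fin n)} (c : Colouring G) (noMono : ColouredEdges.NoMonochromaticP₃ c) where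
  open FiniteAdjacency G

  -- A neighbour of one vertex of an independent triple is adjacent to all three, by absence of
  -- `coP₃`, and so centres a claw. Hence `p` is isolated and would form a `coP₃` with any edge.
  noCoP₃⇒edgeless⊎completeMinusMatching : NoCoP₃ → Edgeless G ⊎ CompleteMinusMatching G
  noCoP₃⇒edgeless⊎completeMinusMatching noCoP₃ with triple? G
  ... | no ¬triple = inj₂ (noCoP₃-no3K₁⇒completeMinusMatching G noCoP₃ (¬triple⇒no3K₁ G ¬triple))
  ... | yes (p , q , r , p≁q , q≁r , p≁r) = inj₁ edgeless
    where
    spread : ∀ {v a b} → v ~ a → a ≁ b → v ~ b
    spread {v} v~a a≁b = ≢-¬≁⇒~ (~-≁⇒≢ v~a a≁b) λ v≁b → noCoP₃ v~a v≁b a≁b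
    not-near-p : ∀ v → ¬ v ~ p
    not-near-p v v~p = noMonochromaticP₃⇒noClaw c noMono v~p (spread v~p p≁q) (spread v~p p≁r) p≁q q≁r p≁r
    edgeless : Edgeless G
    edgeless u v u~v = noCoP₃ u~v (far u v u~v) (far v u (~-sym u~v))
      where
      far : ∀ u v → u ~ v → u ≁ p
      far u v u~v = (λ { refl → not-near-p v (~-sym u~v) }) , not-near-p u

  -- In the presence of 3K₁, no vertex has two neighbours in an independent
  -- triple; extending an independent pair at the middle of a P₃ then contradicts this.
  noK₁+P₃⇒coBipartite⊎cluster : NoK₁+P₃ → CoBipartite G ⊎ Cluster G
  noK₁+P₃⇒coBipartite⊎cluster noK₁+P₃ with triple? G
  ... | no ¬triple = inj₁ (complement-bipartite c (¬triple⇒no3K₁ G ¬triple) noMono)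
  ... | yes (p , q , r , p≁q , q≁r , p≁r) = inj₂ (noP₃⇒cluster G noP₃′)
    where
    -- If `v` is adjacent to `d` as well, it centres a claw; otherwise `d` and the path `a v b` form
    -- `K₁ + P₃`.
    one-neighbour : ∀ {v a b d} → a ≁ b → b ≁ d → a ≁ d → v ~ a → v ~ b → ⊥
    one-neighbour {v} {a} {b} {d} a≁b b≁d a≁d v~a v~b with trichotomous v d
    ... | inj₁ refl       = ~⇒¬≁ (~-sym v~a) a≁d
    ... | inj₂ (inj₁ v~d) = noMonochromaticP₃⇒noClaw c noMono v~a v~b v~d a≁b b≁d a≁d
    ... | inj₂ (inj₂ v≁d) = noK₁+P₃ (≁-sym a≁d) (≁-sym v≁d) (≁-sym b≁d) (~-sym v~a) v~b a≁b

    far-unless : ∀ {v a b d} → a ≁ b → b ≁ d → a ≁ d → v ~ a → v ≁ b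
    far-unless a≁b b≁d a≁d v~a = ~-≁⇒≢ v~a a≁b , one-neighbour a≁b b≁d a≁d v~a

    extend : ∀ v → ∃[ a ] ∃[ b ] v ≁ a × v ≁ b × a ≁ b
    extend v with trichotomous v p | trichotomous v q
    ... | inj₁ refl       | _               = q , r , p≁q , p≁r , q≁r
    ... | inj₂ (inj₁ v~p) | _               =
      q , r , far-unless p≁q q≁r p≁r v~p , far-unless p≁r (≁-sym q≁r) p≁q v~p , q≁r
    ... | inj₂ (inj₂ v≁p) | inj₁ refl       = p , r , v≁p , q≁r , p≁r
    ... | inj₂ (inj₂ v≁p) | inj₂ (inj₁ v~q) = p , r , v≁p , far-unless q≁r (≁-sym p≁r) (≁-sym p≁q) v~q , p≁r
    ... | inj₂ (inj₂ v≁p) | inj₂ (inj₂ v≁q) = p , q , v≁p , v≁q , p≁q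

    noP₃′ : NoP₃
    noP₃′ {u} {v} {w} u~v v~w u≁w with extend v
    ... | a , b , v≁a , v≁b , a≁b =
      -- In the triple `v`, `a`, `b` both `u` and `w` already have the neighbour `v`, so both are
      -- far from `a`. Then `u`, `w`, `a` is an independent triple in which `v` has two neighbours.
      one-neighbour u≁w (far-unless v≁a a≁b v≁b (~-sym v~w)) (far-unless v≁a a≁b v≁b u~v) (~-sym u~v) v~w

-- Colourings avoiding patterns

module _ (G : Graph V) {P : V → V → Set} (P? : Decidable P) (P-sym : Symmetric P) where

  -- Every non-constant colouring constructed below is an instance of this one.
  splitColouring : Colour → Colouring G
  splitColouring x = record
    { colour     = λ u v _ → if does (P? u v) then other x else x
    ; colour-sym = λ u v _ _ → cong (if_then other x else x) (does-⇔ (mk⇔ P-sym P-sym) (P? u v) (P? v u))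
    }

  module _ {x : Colour} where
    open ColouredEdges (splitColouring x)

    splitColouring-other : Edge (other x) u v → P u v
    splitColouring-other {u} {v} (_ , eq) with P? u v
    ... | yes p = p
    ... | no _  = contradiction eq (≢-other x)

    splitColouring-base : Edge x u v → ¬ P u v
    splitColouring-base {u} {v} (_ , eq) with P? u v
    ... | yes _ = contradiction (sym eq) (≢-other x)
    ... | no ¬p = ¬p

module _ (G : Graph V) where

  monochromatic-avoids : ∀ x → Avoids (co x ∷ path x ∷ mixed ∷ []) (monochromatic G (other x))
  monochromatic-avoids x =
    (λ (_ , eq) _ _ → ≢-other x (sym eq)) ∷
    (λ (_ , eq) _ _ → ≢-other x (sym eq)) ∷
    (λ (_ , red≡) (_ , blue≡) _ → contradiction (trans (sym red≡) blue≡) λ ()) ∷ []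

module _ (G : Graph (Fin n)) where
  open FiniteAdjacency G

  CommonNonneighbour : Fin n → Fin n → Set
  CommonNonneighbour u v = ∃[ w ] u ≁ w × v ≁ w

  commonNonneighbour? : Decidable CommonNonneighbour
  commonNonneighbour? u v = any? λ w → u ≁? w ×-dec v ≁? w

  commonNonneighbour-sym : Symmetric CommonNonneighbour
  commonNonneighbour-sym (w , u≁w , v≁w) = w , v≁w , u≁w

  -- Avoiding co x forces colour other x on the edges with a common non-neighbour;
  -- using it on no other edge is the best choice for avoiding path (other x).
  forcedColouring : ∀ x → NoK₁+P₃ → NoC₅ → Σ[ c ∈ Colouring G ] Avoids (co x ∷ path (other x) ∷ []) c
  forcedColouring x noK₁+P₃ noC₅ =
    splitColouring G commonNonneighbour? commonNonneighbour-sym x ,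
    (λ uv u≁w v≁w → base uv (_ , u≁w , v≁w)) ∷
    (λ uv vw u≁w → noForcedP₃ (proj₁ uv) (proj₁ vw) u≁w (forced uv) (forced vw)) ∷ []
    where
    base   = splitColouring-base G commonNonneighbour? commonNonneighbour-sym {x}
    forced = splitColouring-other G commonNonneighbour? commonNonneighbour-sym {x}

    far⇒near : ∀ {u v w p} → u ~ v → v ~ w → u ≁ w → u ≁ p → v ≁ p → p ~ w
    far⇒near {u} {v} {w} {p} u~v v~w u≁w u≁p v≁p with trichotomous p w
    ... | inj₁ refl       = ⊥-elim (~⇒¬≁ v~w v≁p)
    ... | inj₂ (inj₁ p~w) = p~w
    ... | inj₂ (inj₂ p≁w) = ⊥-elim (noK₁+P₃ (≁-sym u≁p) (≁-sym v≁p) p≁w u~v v~w u≁w)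

    -- The vertex `p` must see `w`, and `q` must see `u`. If `p` and `q` are adjacent, then
    -- `v u q p w` is a `C₅`; if not, `p` and the path `v u q` form `K₁ + P₃`.
    noForcedP₃ : ∀ {u v w} → u ~ v → v ~ w → u ≁ w →
                 CommonNonneighbour u v → CommonNonneighbour v w → ⊥
    noForcedP₃ u~v v~w u≁w (p , u≁p , v≁p) (q , v≁q , w≁q)
      with far⇒near u~v v~w u≁w u≁p v≁p
         | far⇒near (~-sym v~w) (~-sym u~v) (≁-sym u≁w) w≁q v≁q
         | trichotomous p q
    ... | p~w | q~u | inj₁ refl       = ~⇒¬≁ (~-sym p~w) w≁q
    ... | p~w | q~u | inj₂ (inj₁ p~q) =
      noC₅ (~-sym u~v) (~-sym q~u) (~-sym p~q) p~w (~-sym v~w) v≁q v≁p u≁p u≁w (≁-sym w≁q)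
    ... | p~w | q~u | inj₂ (inj₂ p≁q) =
      noK₁+P₃ (≁-sym v≁p) (≁-sym u≁p) p≁q (~-sym u~v) (~-sym q~u) v≁q

  -- Each class of the following relation is a component of the complement.
  module Components {x} (c : Colouring G) (co-absent : Absent (co x) c)
                    (path-absent : Absent (path (other x)) c) (mixed-absent′ : Absent mixed c) where
    open ColouredEdges c

    -- Distance at most 2 in the complement. The excluded patterns make this transitive, so it
    -- already describes the components.
    Inseparable : Fin n → Fin n → Set
    Inseparable u v = u ~ v → CommonNonneighbour u v

    inseparable? : Decidable Inseparable
    inseparable? u v = u ~? v →-dec commonNonneighbour? u v

    -- The edge `u v` is forced to have colour `other x`. Colour `x` on `v w` would then give a
    -- `mixed` path, and colour `other x` a monochromatic one.
    twins : ∀ {u v w} → u ~ v → CommonNonneighbour u v → v ~ w → ¬ u ≁ w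
    twins {u} {v} u~v (_ , u≁p , v≁p) v~w u≁w
      with forced-edge c co-absent u~v u≁p v≁p | edge-cases x v~w
    ... | uv | inj₁ vw = mixed-absent c mixed-absent′ x (edge-sym vw) (edge-sym uv) (≁-sym u≁w)
    ... | uv | inj₂ vw = path-absent uv vw u≁w

    inseparable-trans : ∀ {u v w} → Inseparable u v → Inseparable v w → Inseparable u w
    inseparable-trans {u} {v} {w} uv vw u~w with trichotomous u v | trichotomous v w
    ... | inj₁ refl       | _               = vw u~w
    ... | inj₂ _          | inj₁ refl       = uv u~w
    ... | inj₂ (inj₂ u≁v) | inj₂ (inj₂ v≁w) = v , u≁v , ≁-sym v≁w
    ... | inj₂ (inj₁ u~v) | inj₂ (inj₂ v≁w) =
      ⊥-elim (twins (~-sym u~v) (commonNonneighbour-sym (uv u~v)) u~w v≁w)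
    ... | inj₂ (inj₂ u≁v) | inj₂ (inj₁ v~w) =
      ⊥-elim (twins v~w (vw v~w) (~-sym u~w) (≁-sym u≁v))
    -- A common non-neighbour of `u` and `v` is passed on to `w`, since `v` and `w` are twins.
    ... | inj₂ (inj₁ u~v) | inj₂ (inj₁ v~w) with uv u~v
    ...   | p , u≁p , v≁p with trichotomous w p
    ...     | inj₁ refl       = ⊥-elim (~⇒¬≁ v~w v≁p)
    ...     | inj₂ (inj₁ w~p) = ⊥-elim (twins v~w (vw v~w) w~p v≁p)
    ...     | inj₂ (inj₂ w≁p) = p , u≁p , w≁p

    inseparable-isEquivalence : IsEquivalence Inseparable
    inseparable-isEquivalence = record
      { refl  = λ v~v → ⊥-elim (~-irrefl v~v)
      ; sym   = λ uv v~u → commonNonneighbour-sym (uv (~-sym v~u))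
      ; trans = inseparable-trans
      }

    open Classes inseparable? inseparable-isEquivalence

    -- inject₁ makes the number of parts positive even for the graph without vertices.
    part : Fin n → Fin (suc n)
    part = inject₁ ∘ class

    separate : ∀ u v → part u ≢ part v → u ~ v
    separate u v u≢v = decidable-stable (u ~? v) λ ¬u~v →
      u≢v (cong inject₁ (related⇒≡ λ u~v → contradiction u~v ¬u~v))

    noP₃-in-parts : ∀ {u v w} → part u ≡ part v → part v ≡ part w → u ~ v → v ~ w → ¬ u ≁ w
    noP₃-in-parts u≡v _ u~v = twins u~v (≡⇒related (inject₁-injective u≡v) u~v)

    parts-cluster : ∀ i → Cluster (fibreGraph G part i)
    parts-cluster = fibre-cluster G part noP₃-in-parts

    joinOfClusters : JoinOf (suc n) Cluster G
    joinOfClusters = part , separate , parts-cluster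

    joinOfTwoCliques : No3K₁ → JoinOf (suc n) AtMostTwoCliques G
    joinOfTwoCliques no3K₁ = part , separate , λ i →
      anchored⇒twoCliques (fibreGraph G part i) (fibre-trichotomous G part i)
        (λ {u} {v} {w} → cluster⇒noP₃ (fibreGraph G part i) (parts-cluster i) {u} {v} {w})
        (λ u≁v v≁w u≁w → no3K₁ (lift-≁ G part i u≁v) (lift-≁ G part i v≁w) (lift-≁ G part i u≁w))
        (fibre-inhabited? G part i)

  -- Colour `other x` goes inside the parts, `x` across. Non-adjacent vertices share a part, so the
  -- two edges of an induced `P₃` lie both inside or both across, and the former is impossible in a
  -- cluster.
  joinColouring : ∀ x → JoinOf k Cluster G → Σ[ c ∈ Colouring G ] Avoids (co x ∷ path (other x) ∷ mixed ∷ []) c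
  joinColouring x (part , join , isCluster) =
    c ,
    (λ uv u≁w v≁w → across uv (trans (same-part u≁w) (sym (same-part v≁w)))) ∷
    (λ uv vw → join⇒noP₃-in-parts {G = G} isCluster (within uv) (within vw) (proj₁ uv) (proj₁ vw)) ∷
    mixed-colours x within across ∷ []
    where
    SamePart : Fin n → Fin n → Set
    SamePart u v = part u ≡ part v
    c = splitColouring G {SamePart} (λ u v → part u ≟ part v) sym x
    open ColouredEdges c
    within : ∀ {u v} → Edge (other x) u v → SamePart u v
    within = splitColouring-other G (λ u v → part u ≟ part v) sym
    across : ∀ {u v} → Edge x u v → ¬ SamePart u v
    across = splitColouring-base G (λ u v → part u ≟ part v) sym
    same-part : ∀ {u v} → u ≁ v → SamePart u v
    same-part = ≁⇒same-part {G = G} join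
    mixed-colours : ∀ y → (∀ {u v} → Edge (other y) u v → SamePart u v) →
                    (∀ {u v} → Edge y u v → ¬ SamePart u v) → Absent mixed c
    mixed-colours red  within across uv vw u≁w = across uv (trans (same-part u≁w) (sym (within vw)))
    mixed-colours blue within across uv vw u≁w = across vw (trans (sym (within uv)) (same-part u≁w))

  joinOfTwoCliques⇒no3K₁ : JoinOf k AtMostTwoCliques G → No3K₁
  joinOfTwoCliques⇒no3K₁ (part , join , cliques) {u} {v} {w} u≁v v≁w u≁w =
    twoCliques⇒no3K₁ (fibreGraph G part (part w)) (cliques (part w))
      {u , same-part u≁w} {v , same-part v≁w} {w , refl}
      (in-fibre u≁v) (in-fibre v≁w) (in-fibre u≁w)
    where
    same-part : ∀ {u v} → u ≁ v → part u ≡ part v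
    same-part = ≁⇒same-part {G = G} join
    in-fibre : ∀ {i} {a b : Fibre part i} → proj₁ a ≁ proj₁ b → Adjacency._≁_ (fibreGraph G part i) a b
    in-fibre (u≢v , ¬u~v) = u≢v ∘ cong proj₁ , ¬u~v

  -- label tells the two ends of each edge of the matching apart; an edge of G
  -- is coloured by whether the labels of its ends agree.
  matchingColouring : CompleteMinusMatching G → Σ[ c ∈ Colouring G ] Avoids (path red ∷ path blue ∷ []) c
  matchingColouring cmm =
    c ,
    -- The ends of an induced `P₃` are matched, so their labels differ and the middle vertex agrees
    -- with exactly one of them.
    (λ uv vw u≁w → labels-differ u≁w (≢-≢⇒≡ (base uv) (base vw))) ∷
    (λ uv vw u≁w → labels-differ u≁w (trans (split uv) (split vw))) ∷ []
    where
    matched : ∀ {u v w} → u ≁ v → u ≁ w → v ≡ w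
    matched = completeMinusMatching⇒matched {G = G} cmm
    -- The order on `Fin n` breaks the symmetry: the larger end of each matching edge is labelled
    -- `true`.
    smaller-mate? : ∀ u → Dec (∃[ w ] u ≁ w × w Fin.< u)
    smaller-mate? u = any? λ w → u ≁? w ×-dec w <? u
    label : Fin n → Bool
    label u = does (smaller-mate? u)
    SameLabel : Fin n → Fin n → Set
    SameLabel u v = label u ≡ label v
    c = splitColouring G {SameLabel} (λ u v → label u ≟ᵇ label v) sym red
    base  = splitColouring-base G {SameLabel} (λ u v → label u ≟ᵇ label v) sym {red}
    split = splitColouring-other G {SameLabel} (λ u v → label u ≟ᵇ label v) sym {red}
    label-≢ : ∀ {u v} → u ≁ v → u Fin.< v → label u ≢ label v
    label-≢ {u} {v} u≁v u<v eq = contradiction (trans (sym label-u) (trans eq label-v)) λ ()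
      where
      label-u : label u ≡ false
      label-u = dec-false (smaller-mate? u) λ (w , u≁w , w<u) →
        <-asym {x = u} {y = v} u<v (subst (Fin._< u) (matched u≁w u≁v) w<u)
      label-v : label v ≡ true
      label-v = dec-true (smaller-mate? v) (u , ≁-sym u≁v , u<v)
    labels-differ : ∀ {u v} → u ≁ v → label u ≢ label v
    labels-differ {u} {v} u≁v with <-cmp u v
    ... | tri< u<v _ _ = label-≢ u≁v u<v
    ... | tri≈ _ u≡v _ = contradiction u≡v (proj₁ u≁v)
    ... | tri> _ _ v<u = ≢-sym (label-≢ (≁-sym u≁v) v<u)
    ≢-≢⇒≡ : ∀ {a b d : Bool} → a ≢ b → b ≢ d → a ≡ d
    ≢-≢⇒≡ a≢b b≢d = trans (¬-not a≢b) (sym (¬-not (≢-sym b≢d)))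

  ≁⇒different-side : ((side , _) : CoBipartite G) → ∀ {u v} → u ≁ v → side u ≢ side v
  ≁⇒different-side (_ , proper) = proper _ _ ∘ Equivalence.from (complement-~⇔≁ G)

  coBipartite⇒no3K₁ : CoBipartite G → No3K₁
  coBipartite⇒no3K₁ coBip u≁v v≁w u≁w = three-in-two _ _ _
    (≁⇒different-side coBip u≁v) (≁⇒different-side coBip v≁w) (≁⇒different-side coBip u≁w)

  -- Non-adjacent vertices lie on different sides, so the middle of an induced `P₃` shares its side
  -- with exactly one end. An edge across the sides has no common non-neighbour, which would need a
  -- third side.
  coBipartiteColouring : ∀ x → CoBipartite G → Σ[ c ∈ Colouring G ] Avoids (co x ∷ path red ∷ path blue ∷ []) c
  coBipartiteColouring x (side , proper) =
    c ,
    (λ uv u≁w v≁w → three-in-two _ _ _ (across uv) (sides v≁w) (sides u≁w)) ∷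
    noMono red ∷ noMono blue ∷ []
    where
    SameSide : Fin n → Fin n → Set
    SameSide u v = side u ≡ side v
    same? : Decidable SameSide
    same? u v = side u ≟ side v
    c = splitColouring G {SameSide} same? sym x
    open ColouredEdges c
    within : ∀ {u v} → Edge (other x) u v → SameSide u v
    within = splitColouring-other G same? sym
    across : ∀ {u v} → Edge x u v → ¬ SameSide u v
    across = splitColouring-base G same? sym
    sides : ∀ {u v} → u ≁ v → side u ≢ side v
    sides = ≁⇒different-side (side , proper)
    noMono : NoMonochromaticP₃
    noMono y uv vw u≁w with ≡⊎≡other x y
    ... | inj₁ refl = three-in-two _ _ _ (across uv) (across vw) (sides u≁w)
    ... | inj₂ refl = sides u≁w (trans (within uv) (within vw))

-- Classification of the pattern sets

-- Every pattern set between lower and upper expresses ⟦ i ⟧.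
record Interval (i : ClassName) : Set where
  field
    lower upper : List Pattern
    necessary   : {G : Graph (Fin n)} (c : Colouring G) → Avoids lower c → ⟦ i ⟧ (n , G)
    sufficient  : (G : Graph (Fin n)) → ⟦ i ⟧ (n , G) → Σ (Colouring G) (Avoids upper)

open Interval

module _ {G : Graph V} (c : Colouring G) where
  open Adjacency G

  noCoP₃⇒avoids-co : NoCoP₃ → Avoids (co red ∷ co blue ∷ []) c
  noCoP₃⇒avoids-co noCoP₃ = (λ uv → noCoP₃ (proj₁ uv)) ∷ (λ uv → noCoP₃ (proj₁ uv)) ∷ []

  noP₃⇒avoids-paths : NoP₃ → Avoids (path red ∷ path blue ∷ mixed ∷ []) c
  noP₃⇒avoids-paths noP₃ =
    (λ uv vw → noP₃ (proj₁ uv) (proj₁ vw)) ∷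
    (λ uv vw → noP₃ (proj₁ uv) (proj₁ vw)) ∷
    (λ uv vw → noP₃ (proj₁ uv) (proj₁ vw)) ∷ []

elementary⇔ : (G : Graph V) →
  Elementary G ⇔ Σ (Colouring G) (Avoids (path red ∷ path blue ∷ []))
elementary⇔ G = mk⇔
  (λ (c , elem) → c ,
    (λ { (e , p) (f , q) (u≢w , ¬u~w) → elem _ _ _ e f u≢w ¬u~w (trans p (sym q)) }) ∷
    (λ { (e , p) (f , q) (u≢w , ¬u~w) → elem _ _ _ e f u≢w ¬u~w (trans p (sym q)) }) ∷ [])
  (λ { (c , r ∷ b ∷ []) → c , λ u v w e f u≢w ¬u~w eq →
    noMonochromaticP₃ c r b _ (e , refl) (f , sym eq) (u≢w , ¬u~w) })

all-patterns : List Pattern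
all-patterns = independent ∷ co red ∷ co blue ∷ path red ∷ path blue ∷ mixed ∷ []

edgeless-avoids : (G : Graph V) → Edgeless G → (c : Colouring G) →
                  Avoids (co red ∷ co blue ∷ path red ∷ path blue ∷ mixed ∷ []) c
edgeless-avoids G edgeless c =
  (λ (e , _) → ⊥-elim (edgeless _ _ e)) ∷ (λ (e , _) → ⊥-elim (edgeless _ _ e)) ∷
  noP₃⇒avoids-paths c (λ e → ⊥-elim (edgeless _ _ e))

complete-avoids : (G : Graph V) → Complete G → (c : Colouring G) → Avoids all-patterns c
complete-avoids G complete c =
  (λ u≁v → ⊥-elim (no≁ u≁v)) ∷ (λ _ u≁w → ⊥-elim (no≁ u≁w)) ∷ (λ _ u≁w → ⊥-elim (no≁ u≁w)) ∷
  noP₃⇒avoids-paths c (λ _ _ → no≁)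
  where
  no≁ : ∀ {u v} → ¬ Adjacency._≁_ G u v
  no≁ (u≢v , ¬u~v) = ¬u~v (complete _ _ u≢v)

clusterColouring : ∀ x (G : Graph V) → Cluster G →
                   Σ[ c ∈ Colouring G ] Avoids (co x ∷ path red ∷ path blue ∷ mixed ∷ []) c
clusterColouring x G cluster =
  monochromatic G (other x) , List.head (monochromatic-avoids G x) ∷ noP₃⇒avoids-paths _ (cluster⇒noP₃ G cluster)

-- The colour selects between the mirror images of an interval. Patterns of `upper` beyond `lower`
-- are those that the chosen colouring avoids as well.
interval : ∀ i → Colour → Interval i
interval all-graphs x = record
  { lower = []
  ; upper = co x ∷ path x ∷ mixed ∷ []
  ; necessary = λ _ _ → tt
  ; sufficient = λ G _ → _ , monochromatic-avoids G x
  }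
interval 3K₁-free x = record
  { lower = independent ∷ []
  ; upper = independent ∷ co x ∷ path x ∷ mixed ∷ []
  ; necessary = λ { {G = G} _ (a ∷ []) → Equivalence.from (free-3K₁⇔ G) a }
  ; sufficient = λ G free → _ , Equivalence.to (free-3K₁⇔ G) free ∷ monochromatic-avoids G x
  }
interval complete-multipartite x = record
  { lower = co red ∷ co blue ∷ []
  ; upper = co red ∷ co blue ∷ path x ∷ mixed ∷ []
  ; necessary = λ { {G = G} c (r ∷ b ∷ []) → noCoP₃⇒completeMultipartite G (noCoP₃ c r b) }
  ; sufficient = λ G cm → _ ,
      Listₚ.++⁺ (noCoP₃⇒avoids-co _ (completeMultipartite⇒noCoP₃ {G = G} cm))
                (List.tail (monochromatic-avoids G x))
  }
interval complete-minus-matching x = record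
  { lower = independent ∷ co red ∷ co blue ∷ []
  ; upper = independent ∷ co red ∷ co blue ∷ path x ∷ mixed ∷ []
  ; necessary = λ { {G = G} c (a ∷ r ∷ b ∷ []) →
      noCoP₃-no3K₁⇒completeMinusMatching G (noCoP₃ c r b) a }
  ; sufficient = λ G cmm → _ ,
      completeMinusMatching⇒no3K₁ {G = G} cmm ∷
      Listₚ.++⁺ (noCoP₃⇒avoids-co _ (completeMinusMatching⇒noCoP₃ {G = G} cmm))
                (List.tail (monochromatic-avoids G x))
  }
interval edgeless-or-complete-minus-matching x = record
  { lower = co red ∷ co blue ∷ path red ∷ path blue ∷ []
  ; upper = co red ∷ co blue ∷ path red ∷ path blue ∷ []
  ; necessary = λ { c (r ∷ b ∷ r′ ∷ b′ ∷ []) →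
      noCoP₃⇒edgeless⊎completeMinusMatching c (noMonochromaticP₃ c r′ b′) (noCoP₃ c r b) }
  ; sufficient = λ
      { G (inj₁ edgeless) → monochromatic G red ,
          Listₚ.++⁻ˡ (co red ∷ co blue ∷ path red ∷ path blue ∷ []) (edgeless-avoids G edgeless _)
      ; G (inj₂ cmm) → let c , paths = matchingColouring G cmm in c ,
          Listₚ.++⁺ (noCoP₃⇒avoids-co c (completeMinusMatching⇒noCoP₃ {G = G} cmm)) paths
      }
  }
interval edgeless-or-complete x = record
  { lower = co red ∷ co blue ∷ path red ∷ path blue ∷ mixed ∷ []
  ; upper = co red ∷ co blue ∷ path red ∷ path blue ∷ mixed ∷ []
  ; necessary = λ { {G = G} c (r ∷ b ∷ r′ ∷ b′ ∷ m ∷ []) →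
      noCoP₃-noP₃⇒edgeless⊎complete G (noCoP₃ c r b) (noP₃ c r′ b′ m) }
  ; sufficient = λ
      { G (inj₁ edgeless) → monochromatic G red , edgeless-avoids G edgeless _
      ; G (inj₂ complete) → monochromatic G red , List.tail (complete-avoids G complete _)
      }
  }
interval complete-or-2K₁ x = record
  { lower = all-patterns
  ; upper = all-patterns
  ; necessary = λ { {G = G} c (a ∷ r ∷ b ∷ r′ ∷ b′ ∷ m ∷ []) →
      [ (λ edgeless → edgeless-no3K₁⇒complete⊎2K₁ G edgeless a) , inj₁ ]′
        (noCoP₃-noP₃⇒edgeless⊎complete G (noCoP₃ c r b) (noP₃ c r′ b′ m)) }
  ; sufficient = λ
      { G (inj₁ complete) → monochromatic G red , complete-avoids G complete _
      ; G (inj₂ ≅2K₁) → monochromatic G red ,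
          ≅2K₁⇒no3K₁ G ≅2K₁ ∷ edgeless-avoids G (≅2K₁⇒edgeless G ≅2K₁) _
      }
  }
interval clusters x = record
  { lower = path red ∷ path blue ∷ mixed ∷ []
  ; upper = co x ∷ path red ∷ path blue ∷ mixed ∷ []
  ; necessary = λ { {G = G} c (r ∷ b ∷ m ∷ []) → noP₃⇒cluster G (noP₃ c r b m) }
  ; sufficient = clusterColouring x
  }
interval at-most-two-cliques x = record
  { lower = independent ∷ path red ∷ path blue ∷ mixed ∷ []
  ; upper = independent ∷ co x ∷ path red ∷ path blue ∷ mixed ∷ []
  ; necessary = λ { {G = G} c (a ∷ r ∷ b ∷ m ∷ []) → noP₃-no3K₁⇒twoCliques G (noP₃ c r b m) a }
  ; sufficient = λ G cliques →
      map₂ (twoCliques⇒no3K₁ G cliques ∷_) (clusterColouring x G (twoCliques⇒cluster G cliques))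
  }
interval K₁+P₃,C₅-free x = record
  { lower = co x ∷ path (other x) ∷ []
  ; upper = co x ∷ path (other x) ∷ []
  ; necessary = λ { {G = G} c (a ∷ p ∷ []) →
      Equivalence.from (no-K₁+P₃⇔ G) (noK₁+P₃ c a p) ∷ Equivalence.from (no-C₅⇔ G) (noC₅ c a p) ∷ [] }
  ; sufficient = λ { G (noK ∷ noC ∷ []) →
      forcedColouring G x (Equivalence.to (no-K₁+P₃⇔ G) noK) (Equivalence.to (no-C₅⇔ G) noC) }
  }
interval 3K₁,C₅-free x = record
  { lower = independent ∷ co x ∷ path (other x) ∷ []
  ; upper = independent ∷ co x ∷ path (other x) ∷ []
  ; necessary = λ { {G = G} c (i ∷ a ∷ p ∷ []) →
      List.head (Equivalence.from (free-3K₁⇔ G) i) ∷ Equivalence.from (no-C₅⇔ G) (noC₅ c a p) ∷ [] }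
  ; sufficient = λ { G (no3K ∷ noC ∷ []) →
      let no3K₁ = λ {u} {v} {w} → Equivalence.to (free-3K₁⇔ G) (no3K ∷ []) {u} {v} {w} in
      map₂ (no3K₁ ∷_) (forcedColouring G x
        -- `K₁ + P₃` contains `3K₁`: its isolated vertex and the ends of its path.
        (λ t≁u _ t≁w _ _ u≁w → no3K₁ t≁u u≁w t≁w) (Equivalence.to (no-C₅⇔ G) noC)) }
  }
interval joins-of-clusters x = record
  { lower = co x ∷ path (other x) ∷ mixed ∷ []
  ; upper = co x ∷ path (other x) ∷ mixed ∷ []
  ; necessary = λ { {G = G} c (a ∷ p ∷ m ∷ []) → _ , Components.joinOfClusters G c a p m }
  ; sufficient = λ G (_ , join) → joinColouring G x join
  }
interval joins-of-clusters-with-at-most-two-cliques x = record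
  { lower = independent ∷ co x ∷ path (other x) ∷ mixed ∷ []
  ; upper = independent ∷ co x ∷ path (other x) ∷ mixed ∷ []
  ; necessary = λ { {G = G} c (i ∷ a ∷ p ∷ m ∷ []) → _ , Components.joinOfTwoCliques G c a p m i }
  ; sufficient = λ G (_ , part , join , cliques) →
      map₂ (joinOfTwoCliques⇒no3K₁ G (part , join , cliques) ∷_)
        (joinColouring G x (part , join , λ i → twoCliques⇒cluster (fibreGraph G part i) (cliques i)))
  }
interval co-bipartite-or-cluster x = record
  { lower = co x ∷ path red ∷ path blue ∷ []
  ; upper = co x ∷ path red ∷ path blue ∷ []
  ; necessary = λ { c (a ∷ r ∷ b ∷ []) →
      let noMono = noMonochromaticP₃ c r b in
      noK₁+P₃⇒coBipartite⊎cluster c noMono (noK₁+P₃ c a (noMono (other x))) }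
  ; sufficient = λ
      { G (inj₁ coBip) → coBipartiteColouring G x coBip
      ; G (inj₂ cluster) → map₂ (λ { (a ∷ r ∷ b ∷ _) → a ∷ r ∷ b ∷ [] }) (clusterColouring x G cluster)
      }
  }
interval co-bipartite x = record
  { lower = independent ∷ path red ∷ path blue ∷ []
  ; upper = independent ∷ co x ∷ path red ∷ path blue ∷ []
  ; necessary = λ { c (i ∷ r ∷ b ∷ []) → complement-bipartite c i (noMonochromaticP₃ c r b) }
  ; sufficient = λ G coBip → map₂ (coBipartite⇒no3K₁ G coBip ∷_) (coBipartiteColouring G x coBip)
  }
interval elementary x = record
  { lower = path red ∷ path blue ∷ []
  ; upper = path red ∷ path blue ∷ []
  ; necessary = λ c avoids → Equivalence.from (elementary⇔ _) (c , avoids)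
  ; sufficient = λ G → Equivalence.to (elementary⇔ G)
  }

-- This colouring trades `mixed` for the second monochromatic path. Neither this upper set nor the
-- one with `mixed` can be enlarged to hold all three paths, since `P₃` itself is a complete graph
-- minus a matching.
matching-interval : Interval complete-minus-matching
matching-interval = record
  { lower = independent ∷ co red ∷ co blue ∷ []
  ; upper = independent ∷ co red ∷ co blue ∷ path red ∷ path blue ∷ []
  ; necessary = λ { {G = G} c (a ∷ r ∷ b ∷ []) →
      noCoP₃-no3K₁⇒completeMinusMatching G (noCoP₃ c r b) a }
  ; sufficient = λ G cmm → let c , paths = matchingColouring G cmm in c ,
      completeMinusMatching⇒no3K₁ {G = G} cmm ∷
      Listₚ.++⁺ (noCoP₃⇒avoids-co c (completeMinusMatching⇒noCoP₃ {G = G} cmm)) paths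
  }

-- The intervals cover all 64 sets

index : Pattern → Fin 6
index independent = 0F
index (co red)    = 1F
index (co blue)   = 2F
index (path red)  = 3F
index (path blue) = 4F
index mixed       = suc 4F

all-patterns-lookup : ∀ p → lookup all-patterns (index p) ≡ p
all-patterns-lookup independent = refl
all-patterns-lookup (co red)    = refl
all-patterns-lookup (co blue)   = refl
all-patterns-lookup (path red)  = refl
all-patterns-lookup (path blue) = refl
all-patterns-lookup mixed       = refl

_≟ᵖ_ : DecidableEquality Pattern
p ≟ᵖ q = map′ index-injective (cong index) (index p ≟ index q)
  where
  index-injective : index p ≡ index q → p ≡ q
  index-injective eq =
    trans (sym (all-patterns-lookup p)) (trans (cong (lookup all-patterns) eq) (all-patterns-lookup q))

∈-all-patterns : ∀ p → p ∈ all-patterns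
∈-all-patterns p = subst (_∈ all-patterns) (all-patterns-lookup p) (∈-lookup (index p))

open DecSubset _≟ᵖ_ using (_⊆?_)
open DecMembership _≟ᵖ_ using (_∈?_)

sublists : {A : Set} → List A → List (List A)
sublists []       = [ [] ]
sublists (x ∷ xs) = sublists xs ++ map (x ∷_) (sublists xs)

-- Lists of patterns may repeat and permute entries. Filtering `all-patterns` by membership gives a
-- list with the same elements, so 64 lists represent all sets.
filter-∈-sublists : {A : Set} {P : A → Set} (P? : Unary.Decidable P) (xs : List A) →
                    filter P? xs ∈ sublists xs
filter-∈-sublists P? []       = here refl
filter-∈-sublists P? (x ∷ xs) with P? x
... | yes _ = ∈-++⁺ʳ (sublists xs) (∈-map⁺ (x ∷_) (filter-∈-sublists P? xs))
... | no _  = ∈-++⁺ˡ (filter-∈-sublists P? xs)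

class-names : List ClassName
class-names =
  all-graphs ∷ complete-multipartite ∷ clusters ∷ 3K₁-free ∷ complete-minus-matching ∷
  edgeless-or-complete ∷ at-most-two-cliques ∷ complete-or-2K₁ ∷
  edgeless-or-complete-minus-matching ∷ K₁+P₃,C₅-free ∷ 3K₁,C₅-free ∷
  joins-of-clusters ∷ joins-of-clusters-with-at-most-two-cliques ∷
  co-bipartite-or-cluster ∷ co-bipartite ∷ elementary ∷ []

Contains : List Pattern → ∀ {i} → Interval i → Set
Contains ps I = lower I ⊆ ps × ps ⊆ upper I

contains? : ∀ ps {i} (I : Interval i) → Dec (Contains ps I)
contains? ps I = lower I ⊆? ps ×-dec ps ⊆? upper I

all-intervals : List (∃ Interval)
all-intervals =
  (_ , matching-interval) ∷ cartesianProductWith (λ i x → i , interval i x) class-names (red ∷ blue ∷ [])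

-- Settled by evaluation: 64 sublists against 33 intervals, two for each class name and
-- `matching-interval`.
intervals-cover : List.All (λ ps → Any.Any (λ (_ , I) → Contains ps I) all-intervals) (sublists all-patterns)
intervals-cover = toWitness
  {a? = List.all? (λ ps → Any.any? (λ (_ , I) → contains? ps I) all-intervals) _} tt

interval-expresses : ∀ {ps i} (I : Interval i) → Contains ps I → Expresses (map pattern-graph ps) ⟦ i ⟧
interval-expresses {ps = ps} I (lower⊆ , ⊆upper) n G = mk⇔
  (λ G∈ → map₂ (λ {c} avoids → Equivalence.from (colourFree⇔ c ps) (Listₚ.anti-mono ⊆upper avoids))
            (sufficient I G G∈))
  (λ (c , free) → necessary I c (Listₚ.anti-mono lower⊆ (Equivalence.to (colourFree⇔ c ps) free)))

expressed-class : ∀ ps → ∃[ i ] Expresses (map pattern-graph ps) ⟦ i ⟧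
expressed-class ps =
  expresses (Any.satisfied (List.lookup intervals-cover (filter-∈-sublists (_∈? ps) all-patterns)))
  where
  expresses : ∃[ (i , I) ] Contains (filter (_∈? ps) all-patterns) {i} I →
              ∃[ i ] Expresses (map pattern-graph ps) ⟦ i ⟧
  expresses ((i , I) , lower⊆ , ⊆upper) = i , interval-expresses I
    ( (λ p∈ → proj₂ (∈-filter⁻ (_∈? ps) {xs = all-patterns} (lower⊆ p∈)))
    , (λ p∈ → ⊆upper (∈-filter⁺ (_∈? ps) (∈-all-patterns _) p∈)))

⊆-patterns : ∀ {𝓕} → 𝓕 ⊆ patterns → ∃[ ps ] 𝓕 ≡ map pattern-graph ps
⊆-patterns {[]}    _   = [] , refl
⊆-patterns {P ∷ 𝓕} sub with ∈-map⁻ pattern-graph {xs = all-patterns} (sub (here refl)) | ⊆-patterns (sub ∘ there)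
... | p , _ , refl | ps , refl = p ∷ ps , refl

expressed-unique : ∀ {𝓕 𝓒 𝓓} → Expresses 𝓕 𝓒 → Expresses 𝓕 𝓓 → 𝓒 ≐ 𝓓
expressed-unique 𝓒-exp 𝓓-exp =
  (λ {(n , G)} → Equivalence.from (𝓓-exp n G) ∘ Equivalence.to (𝓒-exp n G)) ,
  (λ {(n , G)} → Equivalence.from (𝓒-exp n G) ∘ Equivalence.to (𝓓-exp n G))

expresses-resp-≐ : ∀ {𝓕 𝓒 𝓓} → 𝓒 ≐ 𝓓 → Expresses 𝓕 𝓓 → Expresses 𝓕 𝓒
expresses-resp-≐ (𝓒⊆𝓓 , 𝓓⊆𝓒) exp n G =
  mk⇔ (Equivalence.to (exp n G) ∘ 𝓒⊆𝓓) (𝓓⊆𝓒 ∘ Equivalence.from (exp n G))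

-- The codes of the indicated sets. For `complete-multipartite`, where none is indicated, the two
-- one-edge patterns are chosen.
expressing : ClassName → List Pattern
expressing all-graphs                          = co red ∷ []
expressing complete-multipartite               = co red ∷ co blue ∷ []
expressing clusters                            = path red ∷ path blue ∷ mixed ∷ []
expressing 3K₁-free                            = independent ∷ []
expressing complete-minus-matching             = independent ∷ co red ∷ co blue ∷ []
expressing edgeless-or-complete                = co red ∷ co blue ∷ path red ∷ path blue ∷ mixed ∷ []
expressing at-most-two-cliques                 = independent ∷ path red ∷ path blue ∷ mixed ∷ []
expressing complete-or-2K₁                     = all-patterns
expressing edgeless-or-complete-minus-matching = co red ∷ co blue ∷ path red ∷ path blue ∷ []
expressing K₁+P₃,C₅-free                       = co blue ∷ path red ∷ []
expressing 3K₁,C₅-free                         = independent ∷ co blue ∷ path red ∷ []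
expressing joins-of-clusters                   = co blue ∷ path red ∷ mixed ∷ []
expressing joins-of-clusters-with-at-most-two-cliques = independent ∷ co blue ∷ path red ∷ mixed ∷ []
expressing co-bipartite-or-cluster             = co blue ∷ path red ∷ path blue ∷ []
expressing co-bipartite                        = independent ∷ path red ∷ path blue ∷ []
expressing elementary                          = path red ∷ path blue ∷ []

contained : ∀ i x → {True (contains? (expressing i) (interval i x))} →
            ∃[ y ] Contains (expressing i) (interval i y)
contained i x {yes!} = x , toWitness yes!

-- Intervals with `co x` and `path (other x)` match the indicated sets at `blue`; `all-graphs` is
-- given by `co red` and takes `red`.
expressing-contained : ∀ i → ∃[ x ] Contains (expressing i) (interval i x)
expressing-contained all-graphs = contained all-graphs red
expressing-contained complete-multipartite = contained complete-multipartite blue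
expressing-contained clusters = contained clusters blue
expressing-contained 3K₁-free = contained 3K₁-free blue
expressing-contained complete-minus-matching = contained complete-minus-matching blue
expressing-contained edgeless-or-complete = contained edgeless-or-complete blue
expressing-contained at-most-two-cliques = contained at-most-two-cliques blue
expressing-contained complete-or-2K₁ = contained complete-or-2K₁ blue
expressing-contained edgeless-or-complete-minus-matching = contained edgeless-or-complete-minus-matching blue
expressing-contained K₁+P₃,C₅-free = contained K₁+P₃,C₅-free blue
expressing-contained 3K₁,C₅-free = contained 3K₁,C₅-free blue
expressing-contained joins-of-clusters = contained joins-of-clusters blue
expressing-contained joins-of-clusters-with-at-most-two-cliques = contained joins-of-clusters-with-at-most-two-cliques blue
expressing-contained co-bipartite-or-cluster = contained co-bipartite-or-cluster blue
expressing-contained co-bipartite = contained co-bipartite blue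
expressing-contained elementary = contained elementary blue

expressing-correct : ∀ i → Expresses (map pattern-graph (expressing i)) ⟦ i ⟧
expressing-correct i = let x , contained = expressing-contained i in
  interval-expresses (interval i x) contained

expressing-⊆ : ∀ i → map pattern-graph (expressing i) ⊆ patterns
expressing-⊆ i = Subset.map⁺ pattern-graph (λ _ → ∈-all-patterns _)

theorem32 : ((𝓒 : GraphClass) →
    (∃[ 𝓕 ] 𝓕 ⊆ patterns × Expresses 𝓕 𝓒) ⇔ (∃[ i ] 𝓒 ≐ ⟦ i ⟧))
    × ((i : ClassName) → All (λ 𝓕 → Expresses 𝓕 ⟦ i ⟧) (indicated i))
theorem32 = (λ 𝓒 → mk⇔ classify express) , indicated-correct
  where
  classify : ∀ {𝓒} → ∃[ 𝓕 ] 𝓕 ⊆ patterns × Expresses 𝓕 𝓒 → ∃[ i ] 𝓒 ≐ ⟦ i ⟧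
  classify (𝓕 , 𝓕⊆ , exp) with ⊆-patterns 𝓕⊆
  ... | ps , refl = map₂ (expressed-unique exp) (expressed-class ps)

  express : ∀ {𝓒} → ∃[ i ] 𝓒 ≐ ⟦ i ⟧ → ∃[ 𝓕 ] 𝓕 ⊆ patterns × Expresses 𝓕 𝓒
  express (i , 𝓒≐) = _ , expressing-⊆ i , expresses-resp-≐ 𝓒≐ (expressing-correct i)

  indicated-correct : ∀ i → All (λ 𝓕 → Expresses 𝓕 ⟦ i ⟧) (indicated i)
  -- For each constructor the mapped codes compute to the indicated list itself, hence one clause
  -- per class.
  indicated-correct all-graphs = just (expressing-correct all-graphs)
  indicated-correct complete-multipartite = nothing
  indicated-correct clusters = just (expressing-correct clusters)
  indicated-correct 3K₁-free = just (expressing-correct 3K₁-free)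
  indicated-correct complete-minus-matching = just (expressing-correct complete-minus-matching)
  indicated-correct edgeless-or-complete = just (expressing-correct edgeless-or-complete)
  indicated-correct at-most-two-cliques = just (expressing-correct at-most-two-cliques)
  indicated-correct complete-or-2K₁ = just (expressing-correct complete-or-2K₁)
  indicated-correct edgeless-or-complete-minus-matching = just (expressing-correct edgeless-or-complete-minus-matching)
  indicated-correct K₁+P₃,C₅-free = just (expressing-correct K₁+P₃,C₅-free)
  indicated-correct 3K₁,C₅-free = just (expressing-correct 3K₁,C₅-free)
  indicated-correct joins-of-clusters = just (expressing-correct joins-of-clusters)
  indicated-correct joins-of-clusters-with-at-most-two-cliques = just (expressing-correct joins-of-clusters-with-at-most-two-cliques)
  indicated-correct co-bipartite-or-cluster = just (expressing-correct co-bipartite-or-cluster)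
  indicated-correct co-bipartite = just (expressing-correct co-bipartite)
  indicated-correct elementary = just (expressing-correct elementary)
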